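{- Let $P_{11}$ be a path on eleven vertices. In the $(1:b)$ biased $P_{11}$-minor game on $K_n$ with bias $b=0.99n$, {\tt CleverBreaker} has a strategy which wins with probability tending to $1$ as $n\to\infty$ against {\tt RandomMaker}.
   Context: A $(1:b)$ biased Maker–Breaker game on $K_n$ is played on the board $E(K_n)$: in each round Maker claims one unclaimed edge and then Breaker claims $b$ unclaimed edges (fewer if fewer remain), until all edges are claimed. $M$ denotes Maker's graph at the end. In the $H$-minor game Maker wins iff $H$ is a minor of $M$ (i.e. there exist pairwise disjoint non-empty sets $S_v\subseteq V(M)$, $v\in V(H)$, each inducing a connected subgraph of $M$, with an edge of $M$ between $S_v$ and $S_w$ whenever $vw\in E(H)$); otherwise Breaker wins. {\tt RandomMaker} chooses each of its edges uniformly at random among the currently unclaimed edges; {\tt CleverBreaker} plays a strategy of its choosing. -}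

module Defs where

open import Data.Nat as ℕ using (ℕ; zero; suc; _⊓_; _/_)
open import Data.Fin using (Fin; toℕ)
open import Data.Bool using (Bool; true; false)
open import Data.Vec as Vec using (Vec; []; _∷_)
open import Data.List as List using (List; []; _∷_; _++_; length; concatMap; allFin)
open import Data.List.Relation.Unary.Any using (Any)
open import Data.Product using (Σ; ∃; _×_; _,_; proj₁; proj₂)
open import Data.Sum using (_⊎_)
open import Data.Maybe using (Maybe; just)
open import Data.Integer using (+_)
open import Data.Rational as ℚ using (ℚ; 0ℚ; 1ℚ)
open import Relation.Binary.PropositionalEquality using (_≡_)
open import Relation.Nullary using (¬_)

Graph : ℕ → Set₁
Graph n = Fin n → Fin n → Set

data WalkIn {n : ℕ} (G : Graph n) (S : Fin n → Set) : Fin n → Fin n → Set where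
  here : ∀ {x} → S x → WalkIn G S x x
  step : ∀ {x y z} → S x → G x y → WalkIn G S y z → WalkIn G S x z

-- H is a minor of G: pairwise disjoint non-empty branch sets S_v
-- (encoded by a partial map β : V(G) → V(H) ∪ {nothing}, S_v = β⁻¹(just v)),
-- each inducing a connected subgraph of G, with a G-edge between S_v and S_w
-- whenever vw ∈ E(H).
IsMinor : {k n : ℕ} → Graph k → Graph n → Set
IsMinor {k} {n} H G =
  Σ (Fin n → Maybe (Fin k)) λ β →
    (∀ v → ∃ λ x → β x ≡ just v)
  × (∀ v x y → β x ≡ just v → β y ≡ just v → WalkIn G (λ z → β z ≡ just v) x y)
  × (∀ v w → H v w → ∃ λ x → ∃ λ y → β x ≡ just v × β y ≡ just w × G x y)

Path : (k : ℕ) → Graph k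
Path k i j = (toℕ j ≡ suc (toℕ i)) ⊎ (toℕ i ≡ suc (toℕ j))

Edge : ℕ → Set
Edge n = Σ (Fin n × Fin n) λ p → toℕ (proj₁ p) ℕ.< toℕ (proj₂ p)

allEdges : (n : ℕ) → List (Edge n)
allEdges n = concatMap (λ i → concatMap (λ j → pairs i j) (allFin n)) (allFin n)
  where
  pairs : Fin n → Fin n → List (Edge n)
  pairs i j with toℕ i ℕ.<? toℕ j
  ... | Relation.Nullary.yes p = ((i , j) , p) ∷ []
  ... | Relation.Nullary.no _ = []

graphOf : {n : ℕ} → List (Edge n) → Graph n
graphOf es x y = Any (λ e → proj₁ e ≡ (x , y) ⊎ proj₁ e ≡ (y , x)) es

-- Given Maker's edges (in the order claimed), Breaker's edges, and the list
-- of currently unclaimed edges, Breaker marks the unclaimed edges it claims.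
BreakerStrategy : ℕ → Set
BreakerStrategy n = (maker breaker unclaimed : List (Edge n)) → Vec Bool (length unclaimed)

countTrue : {m : ℕ} → Vec Bool m → ℕ
countTrue [] = 0
countTrue (true ∷ bs) = suc (countTrue bs)
countTrue (false ∷ bs) = countTrue bs

-- Legal for bias b: Breaker always claims exactly min(b, #unclaimed) edges
-- (marks are over distinct unclaimed edges, so they are distinct and unclaimed)
Legal : {n : ℕ} → ℕ → BreakerStrategy n → Set
Legal {n} b s = ∀ maker breaker unclaimed →
  countTrue (s maker breaker unclaimed) ≡ b ⊓ length unclaimed

split : {A : Set} → (xs : List A) → Vec Bool (length xs) → List A × List A
split [] [] = [] , []
split (x ∷ xs) (true ∷ bs) = let r = split xs bs in (x ∷ proj₁ r) , proj₂ r
split (x ∷ xs) (false ∷ bs) = let r = split xs bs in proj₁ r , (x ∷ proj₂ r)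

picks : {A : Set} → List A → List (A × List A)
picks [] = []
picks (x ∷ xs) = (x , xs) ∷ List.map (λ p → proj₁ p , x ∷ proj₂ p) (picks xs)

-- The distribution of outcomes when RandomMaker plays against strategy s.
-- Result: list of leaves (probability , Maker's final edge list).
-- The fuel is the number of remaining rounds bound (initially |E(K_n)|,
-- and each round removes at least one unclaimed edge).

play : {n : ℕ} → BreakerStrategy n → ℕ →
       (maker breaker unclaimed : List (Edge n)) → ℚ → List (ℚ × List (Edge n))
play s _ maker breaker [] w = (w , maker) ∷ []
play s zero maker breaker (_ ∷ _) w = (w , maker) ∷ []
play s (suc f) maker breaker u@(_ ∷ _) w =
  concatMap round (picks u)
  where
  w' : ℚ
  w' = w ℚ.* ((+ 1) ℚ./ length u)
  round : Edge _ × List (Edge _) → List (ℚ × List (Edge _))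
  round (e , rest) =
    let maker' = maker ++ (e ∷ [])
        sp = split rest (s maker' breaker rest)
    in play s f maker' (breaker ++ proj₁ sp) (proj₂ sp) w'

outcomes : {n : ℕ} → BreakerStrategy n → List (ℚ × List (Edge n))
outcomes {n} s = play s (length (allEdges n)) [] [] (allEdges n) 1ℚ

-- Probability (over the outcome list) of the event P is at least r:
-- some collection of leaves, each in the event, has total weight ≥ r.
data Covers {A : Set} (P : A → Set) : List (ℚ × A) → ℚ → Set where
  nil  : Covers P [] 0ℚ
  take : ∀ {w a xs q} → P a → Covers P xs q → Covers P ((w , a) ∷ xs) (w ℚ.+ q)
  skip : ∀ {w a xs q} → Covers P xs q → Covers P ((w , a) ∷ xs) q

ProbAtLeast : {A : Set} → List (ℚ × A) → (A → Set) → ℚ → Set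
ProbAtLeast d P r = ∃ λ q → Covers P d q × r ℚ.≤ q

BreakerWins : {n : ℕ} → List (Edge n) → Set
BreakerWins maker = ¬ IsMinor (Path 11) (graphOf maker)

bias : ℕ → ℕ
bias n = (99 ℕ.* n) / 100

{-# OPTIONS --safe #-}
module Submission where

-- Each vertex touched by Maker gets a role. When Maker joins two fresh
-- vertices, one becomes a hub and the other a rim; a fresh vertex joined to a
-- hub or rim becomes a leaf, and one joined to a leaf becomes a twig. As long
-- as nothing is joined to a twig and no two touched vertices are joined, Maker's
-- graph is a forest of height at most 3, which has no path on 8 vertices as a
-- minor. Breaker claims first the edges between touched vertices, then those
-- from twigs, leaves and rims (in this order) to fresh vertices.
--
-- A new leaf exceeds Breaker's bias by about n/100 edges. This backlog is
-- cleared as soon as Maker joins two fresh vertices, so it behaves like a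
-- subcritical queue: Maker gets O(1) twigs in expectation, each is exposed for
-- one round, and extending one within that round has probability O(1/n) in
-- total. From round n/10 to round 9n/50, while fewer than 3n/250 moves have
-- involved just one fresh vertex, at least a sixth of the moves do; a second
-- moment bound thus makes 3n/250 such moves almost sure. Then Breaker's whole
-- backlog is empty and each further round costs him at most his bias, so that no
-- edge of a rim, leaf or twig remains available to Maker. All the failure
-- probabilities are controlled by one natural-valued potential that does not
-- increase on average.

-- Isolating both ends of a new component would cost Breaker nearly `2n` edges in an opening round,
-- twice what the bias allows. Sparing the hubs makes the defence affordable: a leaf at a hub lies
-- no deeper than one at a rim, and with the edges from hubs to fresh vertices out of the account a
-- move adds at most `n - x` edges to claim after `x` one-fresh moves. The moves that endanger
-- Breaker thus make every later round cheaper. But `x` must pass `n - b`, about n/100, before every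
-- move is sure to cost at most the bias, and the debt built up until then has to be repaid as well.
-- Losing probabilities are numerators over one fixed denominator `D + 1`, where `D = 288000 m²` and
-- `m` is about n/1000. This is at most the number of unclaimed edges throughout the early phase, so
-- declaring `k` of Maker's choices certain losses raises the numerator by at most `k`. The initial
-- numerator is linear in `m`, hence Breaker loses with probability O(1/n).

open import Defs
open import Algebra.Bundles using (CommutativeMonoid)
open import Data.Bool using (Bool; true; false; T; _∧_)
open import Data.Empty using (⊥; ⊥-elim)
open import Data.Fin using (Fin; toℕ; #_)
open import Data.Fin.Properties as Fin using (toℕ-injective)
open import Data.Integer as ℤ using ()
import Data.Integer.Properties as ℤₚ
open import Data.Integer.Tactic.RingSolver using () renaming (solve-∀ to ℤ-solve-∀)
open import Data.List using (List; []; _∷_; _++_; length; concatMap; allFin; map; foldl)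
open import Data.List.Membership.Propositional using (_∈_)
open import Data.List.Membership.Propositional.Properties using (∈-map⁻; ∈-++⁻)
open import Data.List.Properties using (length-tabulate; foldl-++)
open import Data.List.Relation.Unary.Any using (here; there)
open import Data.Maybe using (Maybe; just; nothing)
open import Data.Maybe.Properties using (just-injective)
open import Data.Nat as ℕ
open import Data.Nat.DivMod using (m/n*n≤m; m%n<n; m≡m%n+[m/n]*n; /-monoˡ-≤; m*n/n≡m)
open import Data.Nat.Properties as ℕₚ
open import Data.Nat.Tactic.RingSolver using (solve-∀)
open import Data.Product using (Σ; ∃; _×_; _,_; proj₁; proj₂)
open import Data.Rational as ℚ using (ℚ; 0ℚ; 1ℚ; mkℚ; toℚᵘ; ↧ₙ_)
import Data.Rational.Properties as ℚₚ
open import Data.Rational.Unnormalised as ℚᵘ using (mkℚᵘ; *≡*; *≤*)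
import Data.Rational.Unnormalised.Properties as ℚᵘₚ
open import Data.Sum using (_⊎_; inj₁; inj₂)
open import Data.Unit using (tt)
open import Data.Vec using (Vec; []; _∷_)
open import Function using (_∘_; id)
open import Relation.Binary.PropositionalEquality
open import Relation.Nullary using (¬_; yes; no; Dec)
open import Algebra.Properties.CommutativeSemigroup
  (CommutativeMonoid.commutativeSemigroup ℚₚ.+-0-commutativeMonoid) using (interchange)

-- Sums over lists and the greedy choice

private variable
  A B : Set
  n : ℕ

⟦_⟧ : Bool → ℕ
⟦ true ⟧ = 1
⟦ false ⟧ = 0

∑ : List A → (A → ℕ) → ℕ
∑ [] f = 0
∑ (x ∷ xs) f = f x + ∑ xs f

∑-mono : ∀ {f g : A → ℕ} (xs : List A) → (∀ x → f x ≤ g x) → ∑ xs f ≤ ∑ xs g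
∑-mono [] h = z≤n
∑-mono (x ∷ xs) h = +-mono-≤ (h x) (∑-mono xs h)

∑-cong : ∀ {f g : A → ℕ} (xs : List A) → (∀ x → f x ≡ g x) → ∑ xs f ≡ ∑ xs g
∑-cong [] h = refl
∑-cong (x ∷ xs) h = cong₂ _+_ (h x) (∑-cong xs h)

+-interchange : ∀ a b c d → (a + b) + (c + d) ≡ (a + c) + (b + d)
+-interchange = solve-∀

∑-+ : ∀ (xs : List A) (f g : A → ℕ) → ∑ xs (λ x → f x + g x) ≡ ∑ xs f + ∑ xs g
∑-+ [] f g = refl
∑-+ (x ∷ xs) f g = trans (cong (f x + g x +_) (∑-+ xs f g)) (+-interchange (f x) (g x) _ _)

∑-*ˡ : ∀ (xs : List A) k (f : A → ℕ) → ∑ xs (λ x → k * f x) ≡ k * ∑ xs f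
∑-*ˡ [] k f = sym (*-zeroʳ k)
∑-*ˡ (x ∷ xs) k f = trans (cong (k * f x +_) (∑-*ˡ xs k f)) (sym (*-distribˡ-+ k (f x) _))

∑-zero : ∀ (xs : List A) → ∑ xs (λ _ → 0) ≡ 0
∑-zero [] = refl
∑-zero (x ∷ xs) = ∑-zero xs

∑-one : ∀ (xs : List A) → ∑ xs (λ _ → 1) ≡ length xs
∑-one [] = refl
∑-one (x ∷ xs) = cong suc (∑-one xs)

∑-∈ : ∀ {x} {xs : List A} (f : A → ℕ) → x ∈ xs → f x ≤ ∑ xs f
∑-∈ f (here refl) = m≤m+n _ _
∑-∈ f (there p) = ≤-trans (∑-∈ f p) (m≤n+m _ _)

∑-++ : ∀ (xs ys : List A) f → ∑ (xs ++ ys) f ≡ ∑ xs f + ∑ ys f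
∑-++ [] ys f = refl
∑-++ (x ∷ xs) ys f = trans (cong (f x +_) (∑-++ xs ys f)) (sym (+-assoc (f x) _ _))

∑-concatMap : ∀ (h : A → List B) (xs : List A) f → ∑ (concatMap h xs) f ≡ ∑ xs (λ x → ∑ (h x) f)
∑-concatMap h [] f = refl
∑-concatMap h (x ∷ xs) f =
  trans (∑-++ (h x) (concatMap h xs) f) (cong (∑ (h x) f +_) (∑-concatMap h xs f))

∑-map : ∀ (h : A → B) (xs : List A) f → ∑ (map h xs) f ≡ ∑ xs (f ∘ h)
∑-map h [] f = refl
∑-map h (x ∷ xs) f = cong (f (h x) +_) (∑-map h xs f)

∑-swap : ∀ (xs : List A) (ys : List B) (f : A → B → ℕ) →
  ∑ xs (λ x → ∑ ys (f x)) ≡ ∑ ys (λ y → ∑ xs (λ x → f x y))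
∑-swap [] ys f = sym (∑-zero ys)
∑-swap (x ∷ xs) ys f =
  trans (cong (∑ ys (f x) +_) (∑-swap xs ys f)) (sym (∑-+ ys (f x) _))

∑-picks : ∀ (xs : List A) f → ∑ (picks xs) (f ∘ proj₁) ≡ ∑ xs f
∑-picks [] f = refl
∑-picks (x ∷ xs) f = cong (f x +_) (trans (∑-map _ (picks xs) _) (∑-picks xs f))

picks-∑ : ∀ {xs : List A} {p} → p ∈ picks xs → ∀ f → f (proj₁ p) + ∑ (proj₂ p) f ≡ ∑ xs f
picks-∑ {xs = x ∷ xs} (here refl) f = refl
picks-∑ {xs = x ∷ xs} (there q) f with ∈-map⁻ _ q
... | (y , ys) , r , refl = trans (swap₃ (f y) (f x) _) (cong (f x +_) (picks-∑ r f))
  where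
  swap₃ : ∀ a b c → a + (b + c) ≡ b + (a + c)
  swap₃ = solve-∀

split-∑ : ∀ (xs : List A) bs f → ∑ (proj₁ (split xs bs)) f + ∑ (proj₂ (split xs bs)) f ≡ ∑ xs f
split-∑ [] [] f = refl
split-∑ (x ∷ xs) (true ∷ bs) f =
  trans (+-assoc (f x) _ _) (cong (f x +_) (split-∑ xs bs f))
split-∑ (x ∷ xs) (false ∷ bs) f =
  trans (swap₃ (∑ (proj₁ (split xs bs)) f) (f x) _) (cong (f x +_) (split-∑ xs bs f))
  where
  swap₃ : ∀ a b c → a + (b + c) ≡ b + (a + c)
  swap₃ = solve-∀

module Greedy {A : Set} (prio : A → ℕ) where

  count≤ count< : ℕ → List A → ℕ
  count≤ j xs = ∑ xs λ y → ⟦ prio y ≤ᵇ j ⟧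
  count< j xs = ∑ xs λ y → ⟦ suc (prio y) ≤ᵇ j ⟧

  ⟦≤ᵇ⟧-yes : ∀ {i j} → i ≤ j → ⟦ i ≤ᵇ j ⟧ ≡ 1
  ⟦≤ᵇ⟧-yes {i} {j} p with i ≤ᵇ j | ≤⇒≤ᵇ p
  ... | true | _ = refl

  ⟦≤ᵇ⟧-no : ∀ {i j} → j < i → ⟦ i ≤ᵇ j ⟧ ≡ 0
  ⟦≤ᵇ⟧-no {i} {j} p with i ≤ᵇ j in eq
  ... | false = refl
  ... | true = ⊥-elim (<⇒≱ p (≤ᵇ⇒≤ i j (subst T (sym eq) _)))

  ⟦≤ᵇ⟧-mono : ∀ {i j i′ j′} → (i ≤ j → i′ ≤ j′) → ⟦ i ≤ᵇ j ⟧ ≤ ⟦ i′ ≤ᵇ j′ ⟧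
  ⟦≤ᵇ⟧-mono {i} {j} h with i ≤? j
  ... | yes p = subst (⟦ i ≤ᵇ j ⟧ ≤_) (sym (⟦≤ᵇ⟧-yes (h p))) (≤-reflexive (⟦≤ᵇ⟧-yes p))
  ... | no ¬p = subst (_≤ _) (sym (⟦≤ᵇ⟧-no (≰⇒> ¬p))) z≤n

  -- An element is among the b of least priority (earlier elements winning
  -- ties) iff fewer than b later elements have strictly smaller priority.
  greedy : ℕ → (xs : List A) → Vec Bool (length xs)
  greedy b [] = []
  greedy b (x ∷ xs) with count< (prio x) xs <? b
  ... | yes _ = true ∷ greedy (pred b) xs
  ... | no _ = false ∷ greedy b xs

  count<-length : ∀ j xs → count< j xs ≤ length xs
  count<-length j xs = subst (count< j xs ≤_) (∑-one xs) (∑-mono xs λ y → bound (suc (prio y) ≤ᵇ j))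
    where
    bound : ∀ c → ⟦ c ⟧ ≤ 1
    bound true = ≤-refl
    bound false = z≤n

  greedy-count : ∀ b xs → countTrue (greedy b xs) ≡ b ⊓ length xs
  greedy-count b [] = sym (⊓-zeroʳ b)
  greedy-count b (x ∷ xs) with count< (prio x) xs <? b
  greedy-count (suc b) (x ∷ xs) | yes _ = cong suc (greedy-count b xs)
  greedy-count b (x ∷ xs) | no ≮ =
    trans (greedy-count b xs) (trans (m≤n⇒m⊓n≡m b≤) (sym (m≤n⇒m⊓n≡m (≤-trans b≤ (n≤1+n _)))))
    where
    b≤ : b ≤ length xs
    b≤ = ≤-trans (≮⇒≥ ≮) (count<-length (prio x) xs)

  -- One greedy choice serves all thresholds `j` at once. If an element above `j` is taken, fewer
  -- than `b` later elements lie within `j`, so both sides vanish; if an element within `j` is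
  -- passed over, at least `b` later ones have smaller priority, so the subtraction does not
  -- truncate.
  greedy-count≤ : ∀ j b xs →
    count≤ j (proj₂ (split xs (greedy b xs))) ≡ count≤ j xs ∸ b
  greedy-count≤ j b [] = sym (0∸n≡0 b)
  greedy-count≤ j b (x ∷ xs) with count< (prio x) xs <? b
  greedy-count≤ j (suc b) (x ∷ xs) | yes (s≤s l) with prio x ≤? j
  ... | yes p rewrite ⟦≤ᵇ⟧-yes p = greedy-count≤ j b xs
  ... | no ¬p rewrite ⟦≤ᵇ⟧-no (≰⇒> ¬p) = trans (greedy-count≤ j b xs)
    (trans (m≤n⇒m∸n≡0 c≤b) (sym (m≤n⇒m∸n≡0 (m≤n⇒m≤1+n c≤b))))
    where
    c≤b : count≤ j xs ≤ b
    c≤b = ≤-trans (∑-mono xs λ y → ⟦≤ᵇ⟧-mono λ q → ≤-<-trans q (≰⇒> ¬p)) l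
  greedy-count≤ j b (x ∷ xs) | no ≮ with prio x ≤? j
  ... | yes p rewrite ⟦≤ᵇ⟧-yes p = trans (cong suc (greedy-count≤ j b xs))
    (sym (+-∸-assoc 1 {count≤ j xs} {b} (≤-trans (≮⇒≥ ≮) (∑-mono xs λ y → ⟦≤ᵇ⟧-mono λ q → ≤-trans (<⇒≤ q) p))))
  ... | no ¬p rewrite ⟦≤ᵇ⟧-no (≰⇒> ¬p) = greedy-count≤ j b xs

  greedy-length : ∀ b xs → length (proj₂ (split xs (greedy b xs))) ≡ length xs ∸ b
  greedy-length b [] = sym (0∸n≡0 b)
  greedy-length b (x ∷ xs) with count< (prio x) xs <? b
  greedy-length (suc b) (x ∷ xs) | yes _ = greedy-length b xs
  ... | no ≮ = trans (cong suc (greedy-length b xs))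
    (sym (+-∸-assoc 1 {length xs} {b} (≤-trans (≮⇒≥ ≮) (count<-length (prio x) xs))))

-- Sums over the edges of a complete graph

card : (Fin n → ℕ) → ℕ
card {n} = ∑ (allFin n)

card-tabulate : ∀ {k} {A : Set} (h : Fin k → A) (f : A → ℕ) →
  ∑ (Data.List.tabulate h) f ≡ ∑ (allFin k) (f ∘ h)
card-tabulate {zero} h f = refl
card-tabulate {suc k} h f = cong (f (h Fin.zero) +_)
  (trans (card-tabulate (h ∘ Fin.suc) f) (sym (card-tabulate Fin.suc (f ∘ h))))
  where import Data.Fin.Base as Fin

card-update : ∀ {n} (g h : Fin n → ℕ) (a : Fin n) → (∀ k → k ≢ a → g k ≡ h k) → card g + h a ≡ card h + g a
card-update {suc n} g h a eq = begin
    card g + h a ≡⟨ cong (_+ h a) (split-card g) ⟩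
    (g F0.zero + card (g ∘ F0.suc)) + h a ≡⟨ go a eq ⟩
    (h F0.zero + card (h ∘ F0.suc)) + g a ≡⟨ cong (_+ g a) (sym (split-card h)) ⟩
    card h + g a ∎
  where
  import Data.Fin.Base as F0
  open ≡-Reasoning
  split-card : ∀ (g : Fin (suc n) → ℕ) → card g ≡ g F0.zero + card (g ∘ F0.suc)
  split-card g = cong (g F0.zero +_) (card-tabulate F0.suc g)
  c₁ : ∀ a b c → (a + b) + c ≡ (c + b) + a
  c₁ = solve-∀
  go : ∀ a → (∀ k → k ≢ a → g k ≡ h k) →
    (g F0.zero + card (g ∘ F0.suc)) + h a ≡ (h F0.zero + card (h ∘ F0.suc)) + g a
  go F0.zero eq = trans
    (cong (λ z → (g F0.zero + z) + h F0.zero) (∑-cong (allFin n) λ k → eq (F0.suc k) λ ()))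
    (c₁ (g F0.zero) _ _)
  go (F0.suc a) eq = begin
    (g F0.zero + card (g ∘ F0.suc)) + h (F0.suc a) ≡⟨ +-assoc (g F0.zero) _ _ ⟩
    g F0.zero + (card (g ∘ F0.suc) + h (F0.suc a)) ≡⟨ cong₂ _+_ (eq F0.zero λ ())
      (card-update (g ∘ F0.suc) (h ∘ F0.suc) a λ k ne → eq (F0.suc k) λ { refl → ne refl }) ⟩
    h F0.zero + (card (h ∘ F0.suc) + g (F0.suc a)) ≡⟨ sym (+-assoc (h F0.zero) _ _) ⟩
    (h F0.zero + card (h ∘ F0.suc)) + g (F0.suc a) ∎

card-1 : ∀ n → card {n} (λ _ → 1) ≡ n
card-1 n = trans (∑-one (allFin n)) (length-tabulate id)

indicator : ∀ {P : Set} → Dec P → ℕ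
indicator (yes _) = 1
indicator (no _) = 0

before : Fin n → Fin n → ℕ
before i j = indicator (toℕ i <? toℕ j)

same : Fin n → Fin n → ℕ
same i j = indicator (i Fin.≟ j)

trichotomy : ∀ (i j : Fin n) → before i j + before j i + same i j ≡ 1
trichotomy i j with toℕ i <? toℕ j | toℕ j <? toℕ i | i Fin.≟ j
... | yes p | yes q | _ = ⊥-elim (<-asym p q)
... | yes p | no _ | yes refl = ⊥-elim (<-irrefl refl p)
... | yes p | no _ | no _ = refl
... | no _ | yes q | yes refl = ⊥-elim (<-irrefl refl q)
... | no _ | yes q | no _ = refl
... | no _ | no _ | yes _ = refl
... | no p | no q | no r = ⊥-elim (r (toℕ-injective (≤-antisym (≮⇒≥ q) (≮⇒≥ p))))

onPair : (Fin n → Fin n → ℕ) → Edge n → ℕ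
onPair g ((i , j) , _) = g i j

private
  -- The generator used by `allEdges` is local to it; unification recovers it from the `refl`.
  rows : ∀ n → Σ (Fin n → Fin n → List (Edge n)) λ r →
    allEdges n ≡ concatMap (λ i → concatMap (λ j → r i j) (allFin n)) (allFin n)
  rows n = _ , refl

  ∑-row : ∀ n (g : Fin n → Fin n → ℕ) i j → ∑ (proj₁ (rows n) i j) (onPair g) ≡ before i j * g i j
  ∑-row n g i j with toℕ i <? toℕ j
  ... | yes p = refl
  ... | no _ = refl

∑-allEdges : ∀ n (g : Fin n → Fin n → ℕ) →
  ∑ (allEdges n) (onPair g) ≡ card λ i → card λ j → before i j * g i j
∑-allEdges n g = trans (∑-concatMap _ (allFin n) _) (∑-cong (allFin n) λ i →
  trans (∑-concatMap _ (allFin n) _) (∑-cong (allFin n) λ j → ∑-row n g i j))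

card-same : ∀ (a : Fin n) (g : Fin n → ℕ) → card (λ i → same a i * g i) ≡ g a
card-same {n} a g = trans (sym (+-identityʳ _)) (trans
  (card-update (λ i → same a i * g i) (λ _ → 0) a off)
  (trans (cong (_+ same a a * g a) (∑-zero (allFin n))) on))
  where
  off : ∀ k → k ≢ a → same a k * g k ≡ 0
  off k ne with a Fin.≟ k
  ... | yes refl = ⊥-elim (ne refl)
  ... | no _ = refl
  on : same a a * g a ≡ g a
  on with a Fin.≟ a
  ... | yes _ = +-identityʳ _
  ... | no ne = ⊥-elim (ne refl)

-- Ordered pairs fall into `i < j`, `j < i` and the diagonal; exchanging the two sums turns the
-- second class into the first with `g` transposed.
∑-allEdges-symm : ∀ n (g : Fin n → Fin n → ℕ) →
  ∑ (allEdges n) (onPair λ i j → g i j + g j i) + card (λ i → g i i) ≡ card λ i → card λ j → g i j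
∑-allEdges-symm n g = begin
    ∑ (allEdges n) (onPair λ i j → g i j + g j i) + card (λ i → g i i)
  ≡⟨ cong (_+ card (λ i → g i i)) (trans (∑-allEdges n _) (trans (card₂-cong λ i j → *-distribˡ-+ (before i j) (g i j) (g j i)) card₂-+)) ⟩
    (card₂ (λ i j → before i j * g i j) + card₂ (λ i j → before i j * g j i)) + card (λ i → g i i)
  ≡⟨ cong₂ (λ a b → card₂ (λ i j → before i j * g i j) + a + b)
       (∑-swap (allFin n) (allFin n) _) (∑-cong (allFin n) λ i → sym (card-same i (g i))) ⟩
    (card₂ (λ i j → before i j * g i j) + card₂ (λ i j → before j i * g i j)) + card₂ (λ i j → same i j * g i j)
  ≡⟨ cong (_+ card₂ (λ i j → same i j * g i j)) (sym card₂-+) ⟩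
    card₂ (λ i j → before i j * g i j + before j i * g i j) + card₂ (λ i j → same i j * g i j)
  ≡⟨ sym card₂-+ ⟩
    card₂ (λ i j → before i j * g i j + before j i * g i j + same i j * g i j)
  ≡⟨ (card₂-cong λ i j → trans (dist (before i j) (before j i) (same i j) (g i j))
       (trans (cong (_* g i j) (trichotomy i j)) (*-identityˡ _))) ⟩
    card₂ g ∎
  where
  open ≡-Reasoning
  card₂ : (Fin n → Fin n → ℕ) → ℕ
  card₂ g = card λ i → card λ j → g i j
  card₂-cong : ∀ {g h} → (∀ i j → g i j ≡ h i j) → card₂ g ≡ card₂ h
  card₂-cong e = ∑-cong (allFin n) λ i → ∑-cong (allFin n) (e i)
  card₂-+ : ∀ {g h} → card₂ (λ i j → g i j + h i j) ≡ card₂ g + card₂ h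
  card₂-+ = trans (∑-cong (allFin n) λ i → ∑-+ (allFin n) _ _) (∑-+ (allFin n) _ _)
  dist : ∀ a b c d → a * d + b * d + c * d ≡ (a + b + c) * d
  dist = solve-∀

allEdges-product : ∀ (f h : Fin n → ℕ) →
  ∑ (allEdges n) (onPair λ i j → f i * h j + f j * h i) ≤ card f * card h
allEdges-product {n} f h = begin
    ∑ (allEdges n) (onPair λ i j → f i * h j + f j * h i)
  ≤⟨ m≤m+n _ _ ⟩
    ∑ (allEdges n) (onPair λ i j → f i * h j + f j * h i) + card (λ i → f i * h i)
  ≡⟨ ∑-allEdges-symm n (λ i j → f i * h j) ⟩
    (card λ i → card λ j → f i * h j)
  ≡⟨ ∑-cong (allFin n) (λ i → trans (∑-*ˡ (allFin n) (f i) h) (*-comm (f i) _)) ⟩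
    (card λ i → card h * f i)
  ≡⟨ trans (∑-*ˡ (allFin n) (card h) f) (*-comm (card h) _) ⟩
    card f * card h ∎
  where open ≤-Reasoning

allEdges-length : ∀ n → 2 * length (allEdges n) + n ≡ n * n
allEdges-length n = begin
    2 * length (allEdges n) + n
  ≡⟨ cong₂ _+_ (trans (cong (2 *_) (sym (∑-one (allEdges n)))) (sym (∑-*ˡ (allEdges n) 2 _))) (sym (card-1 n)) ⟩
    ∑ (allEdges n) (onPair λ _ _ → 1 + 1) + card {n} (λ _ → 1)
  ≡⟨ ∑-allEdges-symm n (λ _ _ → 1) ⟩
    (card {n} λ i → card {n} λ j → 1)
  ≡⟨ ∑-cong (allFin n) (λ _ → trans (card-1 n) (sym (*-identityʳ n))) ⟩
    (card {n} λ i → n * 1)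
  ≡⟨ trans (∑-*ˡ (allFin n) n _) (cong (n *_) (card-1 n)) ⟩
    n * n ∎
  where open ≡-Reasoning

allEdges-star : ∀ (a : Fin n) (x : Fin n → ℕ) →
  ∑ (allEdges n) (onPair λ i j → same a i * x j + same a j * x i) ≤ card x
allEdges-star {n} a x = ≤-trans (allEdges-product (same a) x)
  (≤-reflexive (trans (cong (_* card x) (trans (∑-cong (allFin n) λ i → sym (*-identityʳ _)) (card-same a λ _ → 1))) (*-identityˡ _)))

-- Roles and priorities

data Role : Set where
  fresh hub rim leaf twig : Role

Roles : ℕ → Set
Roles n = Fin n → Role

_[_≔_] : Roles n → Fin n → Role → Roles n
(ρ [ f ≔ r ]) k with k Fin.≟ f
... | yes _ = r
... | no _ = ρ k

-- There is no rank above that of a twig: a move extending one breaks the forest, and is either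
-- impossible or charged as a certain loss.
child : Role → Role
child leaf = twig
child twig = twig
child _ = leaf

step-roles : Roles n → Edge n → Roles n
step-roles ρ ((i , j) , _) with ρ i | ρ j
... | fresh | fresh = (ρ [ i ≔ hub ]) [ j ≔ rim ]
... | fresh | r = ρ [ i ≔ child r ]
... | r | fresh = ρ [ j ≔ child r ]
... | _ | _ = ρ

roles : List (Edge n) → Roles n
roles = foldl step-roles λ _ → fresh

-- Small means urgent, ordered by damage: growth at a twig breaks the forest, at a leaf it makes a
-- twig, at a rim a leaf. Hubs and fresh vertices lie above 3, beyond every threshold that is
-- counted.
level : Role → ℕ
level fresh = 4
level hub = 4
level rim = 3
level leaf = 2
level twig = 1

priority : Role → Role → ℕ
priority fresh r = level r
priority r fresh = level r
priority _ _ = 0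

priority-comm : ∀ r s → priority r s ≡ priority s r
priority-comm fresh fresh = refl
priority-comm fresh hub = refl
priority-comm fresh rim = refl
priority-comm fresh leaf = refl
priority-comm fresh twig = refl
priority-comm hub fresh = refl
priority-comm hub hub = refl
priority-comm hub rim = refl
priority-comm hub leaf = refl
priority-comm hub twig = refl
priority-comm rim fresh = refl
priority-comm rim hub = refl
priority-comm rim rim = refl
priority-comm rim leaf = refl
priority-comm rim twig = refl
priority-comm leaf fresh = refl
priority-comm leaf hub = refl
priority-comm leaf rim = refl
priority-comm leaf leaf = refl
priority-comm leaf twig = refl
priority-comm twig fresh = refl
priority-comm twig hub = refl
priority-comm twig rim = refl
priority-comm twig leaf = refl
priority-comm twig twig = refl

edgePriority : Roles n → Edge n → ℕ
edgePriority ρ = onPair λ i j → priority (ρ i) (ρ j)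

breaker : (n : ℕ) → BreakerStrategy n
breaker n mk _ u = Greedy.greedy (edgePriority (roles mk)) (bias n) u

isHub isFresh isTouched isOpen : Role → ℕ
isHub hub = 1
isHub _ = 0
isFresh fresh = 1
isFresh _ = 0
isTouched fresh = 0
isTouched _ = 1
isOpen r = isHub r + isFresh r

-- Proof by reflection: for concrete `f` and `g` the implicit argument evaluates to the unit type
-- and is filled in automatically.
role-≤ : ∀ (f g : Role → ℕ) →
  {T ((f fresh ≤ᵇ g fresh) ∧ (f hub ≤ᵇ g hub) ∧ (f rim ≤ᵇ g rim) ∧ (f leaf ≤ᵇ g leaf) ∧ (f twig ≤ᵇ g twig))} →
  ∀ r → f r ≤ g r
role-≤ f g {p} r with f fresh ≤ᵇ g fresh in p₁ | f hub ≤ᵇ g hub in p₂ | f rim ≤ᵇ g rim in p₃ | f leaf ≤ᵇ g leaf in p₄ | f twig ≤ᵇ g twig in p₅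
role-≤ f g fresh | true | true | true | true | true = ≤ᵇ⇒≤ _ _ (subst T (sym p₁) tt)
role-≤ f g hub | true | true | true | true | true = ≤ᵇ⇒≤ _ _ (subst T (sym p₂) tt)
role-≤ f g rim | true | true | true | true | true = ≤ᵇ⇒≤ _ _ (subst T (sym p₃) tt)
role-≤ f g leaf | true | true | true | true | true = ≤ᵇ⇒≤ _ _ (subst T (sym p₄) tt)
role-≤ f g twig | true | true | true | true | true = ≤ᵇ⇒≤ _ _ (subst T (sym p₅) tt)

-- Stands for inclusion as multisets. Dominating every weight sum is all that is used of it, and it
-- passes to sublists without any reasoning about permutations.
_≼allEdges : List (Edge n) → Set
u ≼allEdges = ∀ f → ∑ u f ≤ ∑ (allEdges _) f

card-roles : ∀ (x : Role → ℕ) (ρ : Roles n) {f} r → ρ f ≡ fresh →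
  card (x ∘ (ρ [ f ≔ r ])) + x fresh ≡ card (x ∘ ρ) + x r
card-roles x ρ {f} r ρf = trans (cong (λ s → card (x ∘ (ρ [ f ≔ r ])) + x s) (sym ρf))
  (trans (card-update (x ∘ (ρ [ f ≔ r ])) (x ∘ ρ) f off) (cong (card (x ∘ ρ) +_) on))
  where
  off : ∀ k → k ≢ f → x ((ρ [ f ≔ r ]) k) ≡ x (ρ k)
  off k ne with k Fin.≟ f
  ... | yes e = ⊥-elim (ne e)
  ... | no _ = refl
  on : x ((ρ [ f ≔ r ]) f) ≡ x r
  on with f Fin.≟ f
  ... | yes e = refl
  ... | no ne = ⊥-elim (ne refl)

-- Effect of a new role on the priority counts and the census

count≤ : ℕ → Roles n → List (Edge n) → ℕ
count≤ j ρ u = ∑ u λ e → ⟦ edgePriority ρ e ≤ᵇ j ⟧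

gain : ℕ → Role → Role → ℕ
gain j r s = ⟦ priority r s ≤ᵇ j ⟧

-- x weighs the edges between f and a vertex of a given role which the new role
-- of f brings to priority at most j.
count-update : ∀ j {u : List (Edge n)} (ρ : Roles n) {f} r (x : Role → ℕ) → u ≼allEdges → ρ f ≡ fresh →
  (∀ s → gain j r s ≤ gain j fresh s + x s) →
  count≤ j (ρ [ f ≔ r ]) u ≤ count≤ j ρ u + card (x ∘ ρ)
count-update j {u} ρ {f} r x u≼ ρf h = begin
    count≤ j (ρ [ f ≔ r ]) u
  ≤⟨ ∑-mono u pointwise ⟩
    ∑ u (λ e → ⟦ edgePriority ρ e ≤ᵇ j ⟧ + onPair star e)
  ≡⟨ ∑-+ u _ _ ⟩
    count≤ j ρ u + ∑ u (onPair star)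
  ≤⟨ +-monoʳ-≤ (count≤ j ρ u) (≤-trans (u≼ _) (allEdges-star f (x ∘ ρ))) ⟩
    count≤ j ρ u + card (x ∘ ρ) ∎
  where
  open ≤-Reasoning
  star : Fin _ → Fin _ → ℕ
  star i k = same f i * x (ρ k) + same f k * x (ρ i)
  old : ∀ s → priority (ρ f) s ≡ priority fresh s
  old s = cong (λ r → priority r s) ρf
  pointwise : ∀ e → ⟦ edgePriority (ρ [ f ≔ r ]) e ≤ᵇ j ⟧ ≤ ⟦ edgePriority ρ e ≤ᵇ j ⟧ + onPair star e
  pointwise ((i , k) , i<k) with i Fin.≟ f | k Fin.≟ f | f Fin.≟ i | f Fin.≟ k
  ... | yes refl | yes refl | _ | _ = ⊥-elim (<-irrefl refl i<k)
  ... | yes refl | no _ | no ne | _ = ⊥-elim (ne refl)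
  ... | yes refl | no ne | yes _ | yes e = ⊥-elim (ne (sym e))
  ... | yes refl | no _ | yes _ | no _ = ≤-trans (h (ρ k)) (≤-reflexive
        (cong₂ (λ p q → ⟦ p ≤ᵇ j ⟧ + q) (sym (old (ρ k))) (sym (trans (+-identityʳ _) (+-identityʳ _)))))
  ... | no _ | yes refl | _ | no ne = ⊥-elim (ne refl)
  ... | no ne | yes refl | yes e | _ = ⊥-elim (ne (sym e))
  ... | no _ | yes refl | no _ | yes _ = subst (λ p → ⟦ p ≤ᵇ j ⟧ ≤ _) (priority-comm r (ρ i))
        (≤-trans (h (ρ i)) (≤-reflexive
          (cong₂ (λ p q → ⟦ p ≤ᵇ j ⟧ + q) (trans (sym (old (ρ i))) (priority-comm (ρ f) (ρ i))) (sym (+-identityʳ _)))))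
  ... | no _ | no _ | _ | _ = m≤m+n _ _

-- c edges joined two fresh vertices and x edges one.
record Census (ρ : Roles n) (x c : ℕ) : Set where
  field
    hubs : card (isHub ∘ ρ) ≡ c
    touched : card (isTouched ∘ ρ) ≡ x + 2 * c
    freshes : card (isFresh ∘ ρ) + (x + 2 * c) ≡ n

census-plant : ∀ {ρ : Roles n} {x c i j} → Census ρ x c → ρ i ≡ fresh → ρ j ≡ fresh → i ≢ j →
  Census ((ρ [ i ≔ hub ]) [ j ≔ rim ]) x (suc c)
census-plant {ρ = ρ} {x} {c} {i} {j} cen ρi ρj i≢j = record
  { hubs = trans (sym (+-identityʳ _)) (trans (card-roles isHub ρ₁ rim ρ₁j) (trans (+-identityʳ _)
      (trans (sym (+-identityʳ _)) (trans (card-roles isHub ρ hub ρi) (trans (cong (_+ 1) hubs) (+-comm c 1))))))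
  ; touched = trans (sym (+-identityʳ _)) (trans (card-roles isTouched ρ₁ rim ρ₁j)
      (trans (cong (_+ 1) (trans (sym (+-identityʳ _)) (card-roles isTouched ρ hub ρi)))
        (trans (cong (λ z → z + 1 + 1) touched) (two x c))))
  ; freshes = trans (cong (card (isFresh ∘ (ρ₁ [ j ≔ rim ])) +_) (sym (two x c)))
      (trans (three (card (isFresh ∘ (ρ₁ [ j ≔ rim ]))) (x + 2 * c)) (trans (cong (λ z → z + 1 + (x + 2 * c)) (trans (card-roles isFresh ρ₁ rim ρ₁j) (+-identityʳ _)))
        (trans (cong (_+ (x + 2 * c)) (trans (card-roles isFresh ρ hub ρi) (+-identityʳ _))) freshes)))
  }
  where
  open Census cen
  ρ₁ = ρ [ i ≔ hub ]
  ρ₁j : ρ₁ j ≡ fresh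
  ρ₁j with j Fin.≟ i
  ... | yes e = ⊥-elim (i≢j (sym e))
  ... | no _ = ρj
  two : ∀ x c → x + 2 * c + 1 + 1 ≡ x + 2 * suc c
  two = solve-∀
  three : ∀ a b → a + (b + 1 + 1) ≡ a + 1 + 1 + b
  three = solve-∀

census-attach : ∀ {ρ : Roles n} {x c f} r → Census ρ x c → ρ f ≡ fresh →
  isHub r ≡ 0 → isTouched r ≡ 1 → isFresh r ≡ 0 → Census (ρ [ f ≔ r ]) (suc x) c
census-attach {ρ = ρ} {x} {c} {f} r cen ρf r₁ r₂ r₃ = record
  { hubs = trans (sym (+-identityʳ _)) (trans (card-roles isHub ρ r ρf) (trans (cong₂ _+_ hubs r₁) (+-identityʳ _)))
  ; touched = trans (sym (+-identityʳ _)) (trans (card-roles isTouched ρ r ρf) (trans (cong₂ _+_ touched r₂) (+-comm _ 1)))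
  ; freshes = trans (+-suc _ _) (trans (cong (_+ (x + 2 * c))
      (trans (+-comm 1 (card (isFresh ∘ (ρ [ f ≔ r ])))) (trans (card-roles isFresh ρ r ρf) (trans (cong (_ +_) r₃) (+-identityʳ _))))) freshes)
  }
  where open Census cen

-- Forests of bounded height

module Ranked {n} {G : Graph n} (parent : Fin n → Maybe (Fin n)) (rank : Fin n → ℕ)
  (edges : ∀ {x y} → G x y → parent x ≡ just y ⊎ parent y ≡ just x)
  (decreasing : ∀ {x y} → parent x ≡ just y → rank y < rank x) where

  data Below (S : Fin n → Set) (x : Fin n) : Fin n → Set where
    top : Below S x x
    down : ∀ {y z} → S y → parent z ≡ just y → Below S x y → Below S x z

  below-rank : ∀ {S x z} → Below S x z → rank x ≤ rank z
  below-rank top = ≤-refl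
  below-rank (down _ p b) = ≤-trans (below-rank b) (<⇒≤ (decreasing p))

  -- A walk inside S can only leave the descendants of x through the parent of x.
  walk-below : ∀ {S x y z p} → parent x ≡ just p → ¬ S p → WalkIn G S y z → Below S x y → Below S x z
  walk-below px ¬p (here _) b = b
  walk-below {S} {x} px ¬p (step {y = y′} Sy g w) b = walk-below px ¬p w (next Sy b (edges g) (start w))
    where
    start : ∀ {u v} → WalkIn G S u v → S u
    start (here s) = s
    start (step s _ _) = s
    next : ∀ {y} → S y → Below S x y → parent y ≡ just y′ ⊎ parent y′ ≡ just y → S y′ → Below S x y′
    next _ top (inj₁ q) s = ⊥-elim (¬p (subst S (just-injective (trans (sym q) px)) s))
    next _ (down _ q b) (inj₁ q′) s = subst (Below S x) (just-injective (trans (sym q) q′)) b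
    next Sy b (inj₂ q) s = down Sy q b

  -- A vertex of one branch set whose parent lies in another is the top of its
  -- branch set.
  module _ (β : Fin n → Maybe (Fin 11))
    (connected : ∀ v x y → β x ≡ just v → β y ≡ just v → WalkIn G (λ z → β z ≡ just v) x y)
    (adjacent : ∀ v w → Path 11 v w → ∃ λ x → ∃ λ y → β x ≡ just v × β y ≡ just w × G x y) where

    record Step (v w : Fin 11) : Set where
      field
        lower upper : Fin n
        lower∈ : β lower ≡ just v
        upper∈ : β upper ≡ just w
        parent≡ : parent lower ≡ just upper
    open Step

    step-either : ∀ v w → Path 11 v w → Step v w ⊎ Step w v
    step-either v w p with adjacent v w p
    ... | x , y , βx , βy , g with edges g
    ... | inj₁ q = inj₁ record { lower∈ = βx ; upper∈ = βy ; parent≡ = q }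
    ... | inj₂ q = inj₂ record { lower∈ = βy ; upper∈ = βx ; parent≡ = q }

    outside : ∀ {v w} → v ≢ w → (s : Step v w) → β (upper s) ≢ just v
    outside v≢w s e = v≢w (just-injective (trans (sym e) (upper∈ s)))

    below-lower : ∀ {v w} → v ≢ w → (s : Step v w) → ∀ {z} → β z ≡ just v →
      Below (λ z → β z ≡ just v) (lower s) z
    below-lower {v} v≢w s {z} βz =
      walk-below (parent≡ s) (outside v≢w s) (connected v (lower s) z (lower∈ s) βz) top

    -- The first step arrives at a descendant of the top of the middle branch set, and the second
    -- step leaves from that top.
    ascend : ∀ {u v w} → v ≢ w → (s : Step u v) (s′ : Step v w) → rank (lower s′) < rank (lower s)
    ascend v≢w s s′ = ≤-<-trans (below-rank (below-lower v≢w s′ (upper∈ s))) (decreasing (parent≡ s))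

    -- Both steps leave `v` from its top, hence towards the same parent. So a path that has once
    -- gone down can never go up again.
    parents-agree : ∀ {u v w} → v ≢ u → v ≢ w → (s : Step v u) (s′ : Step v w) → u ≡ w
    parents-agree v≢u v≢w s s′ with lower s′ | lower∈ s′ | parent≡ s′ | below-lower v≢u s (lower∈ s′)
    ... | _ | _ | p | top = just-injective (trans (sym (upper∈ s))
          (trans (cong β (just-injective (trans (sym (parent≡ s)) p))) (upper∈ s′)))
    ... | _ | _ | p | down βy q _ = ⊥-elim (outside v≢w s′ (trans (cong β (just-injective (trans (sym p) q))) βy))

  no-long-path : (∀ x → rank x ≤ 3) → ¬ IsMinor (Path 11) G
  no-long-path bounded (β , _ , connected , adjacent) = main
    where
    Up Down : Fin 11 → Fin 11 → Set
    Up v w = Step β connected adjacent v w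
    Down v w = Step β connected adjacent w v
    either = step-either β connected adjacent
    ascend′ = λ {u} {v} {w} → ascend β connected adjacent {u} {v} {w}
    turn : ∀ {u v w} → v ≢ u → v ≢ w → u ≢ w → Down u v → ¬ Up v w
    turn a b c s s′ = c (parents-agree β connected adjacent a b s s′)
    chain : ∀ {a b c d e} → b ≢ c → c ≢ d → d ≢ e → Up a b → Up b c → Up c d → Up d e → ⊥
    chain p q r s₁ s₂ s₃ s₄ = <⇒≱ (≤-<-trans z≤n (decreasing (Step.parent≡ s₄)))
      (+-cancelˡ-≤ 3 _ 0 (≤-trans (+-monoʳ-≤ 3 ≤-refl)
        (≤-trans (s≤s (s≤s (ascend′ r s₃ s₄))) (≤-trans (s≤s (ascend′ q s₂ s₃)) (≤-trans (ascend′ p s₁ s₂) (bounded _))))))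
    forward : ∀ {u v w} → v ≢ u → v ≢ w → u ≢ w → Path 11 v w → Down u v → Down v w
    forward a b c p s with either _ _ p
    ... | inj₁ up = ⊥-elim (turn a b c s up)
    ... | inj₂ dn = dn
    backward : ∀ {u v w} → v ≢ u → v ≢ w → u ≢ w → Path 11 u v → Up v w → Up u v
    backward a b c p s with either _ _ p
    ... | inj₁ up = up
    ... | inj₂ dn = ⊥-elim (turn a b c dn s)
    -- Up-steps precede down-steps, and four equal steps in a row need five ranks.
    main : ⊥
    main with either (# 3) (# 4) (inj₁ refl)
    ... | inj₁ u₃ = chain (λ ()) (λ ()) (λ ()) u₀ u₁ u₂ u₃
      where
      u₂ = backward {# 2} {# 3} {# 4} (λ ()) (λ ()) (λ ()) (inj₁ refl) u₃
      u₁ = backward {# 1} {# 2} {# 3} (λ ()) (λ ()) (λ ()) (inj₁ refl) u₂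
      u₀ = backward {# 0} {# 1} {# 2} (λ ()) (λ ()) (λ ()) (inj₁ refl) u₁
    ... | inj₂ d₃ = chain (λ ()) (λ ()) (λ ()) d₆ d₅ d₄ d₃
      where
      d₄ = forward {# 3} {# 4} {# 5} (λ ()) (λ ()) (λ ()) (inj₁ refl) d₃
      d₅ = forward {# 4} {# 5} {# 6} (λ ()) (λ ()) (λ ()) (inj₁ refl) d₄
      d₆ = forward {# 5} {# 6} {# 7} (λ ()) (λ ()) (λ ()) (inj₁ refl) d₅

rankOf : Role → ℕ
rankOf fresh = 0
rankOf hub = 0
rankOf rim = 1
rankOf leaf = 2
rankOf twig = 3

-- The field `touched` keeps fresh vertices out of the parent relation, so that giving one of them a
-- role disturbs no earlier rank comparison.
record Forest {n} (mk : List (Edge n)) (ρ : Roles n) : Set where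
  field
    parent : Fin n → Maybe (Fin n)
    edges : ∀ {e} → e ∈ mk → parent (proj₁ (proj₁ e)) ≡ just (proj₂ (proj₁ e)) ⊎ parent (proj₂ (proj₁ e)) ≡ just (proj₁ (proj₁ e))
    touched : ∀ {x y} → parent x ≡ just y → ρ x ≢ fresh × ρ y ≢ fresh
    decreasing : ∀ {x y} → parent x ≡ just y → rankOf (ρ y) < rankOf (ρ x)

≔-same : ∀ (ρ : Roles n) f {r} → (ρ [ f ≔ r ]) f ≡ r
≔-same ρ f with f Fin.≟ f
... | yes _ = refl
... | no ne = ⊥-elim (ne refl)

≔-other : ∀ (ρ : Roles n) {f r k} → k ≢ f → (ρ [ f ≔ r ]) k ≡ ρ k
≔-other ρ {f} {r} {k} ne with k Fin.≟ f
... | yes e = ⊥-elim (ne e)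
... | no _ = refl

≔-touched : ∀ (ρ : Roles n) {f r k} → ρ f ≡ fresh → ρ k ≢ fresh → (ρ [ f ≔ r ]) k ≡ ρ k
≔-touched ρ ρf ρk = ≔-other ρ λ { refl → ρk ρf }

forest-plant : ∀ {mk} {ρ : Roles n} {f} r → Forest mk ρ → ρ f ≡ fresh → Forest mk (ρ [ f ≔ r ])
forest-plant {ρ = ρ} {f} r F ρf = record
  { parent = parent ; edges = edges
  ; touched = λ p → (λ q → proj₁ (touched p) (trans (sym (≔-touched ρ ρf (proj₁ (touched p)))) q))
                  , (λ q → proj₂ (touched p) (trans (sym (≔-touched ρ ρf (proj₂ (touched p)))) q))
  ; decreasing = λ p → subst₂ (λ r s → rankOf r < rankOf s)
      (sym (≔-touched ρ ρf (proj₂ (touched p)))) (sym (≔-touched ρ ρf (proj₁ (touched p)))) (decreasing p)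
  }
  where open Forest F

forest-attach : ∀ {mk} {ρ : Roles n} {e} f y r → Forest mk ρ → ρ f ≡ fresh → ρ y ≢ fresh →
  r ≢ fresh → rankOf (ρ y) < rankOf r → proj₁ e ≡ (f , y) ⊎ proj₁ e ≡ (y , f) →
  Forest (mk ++ e ∷ []) (ρ [ f ≔ r ])
forest-attach {n = n} {mk} {ρ} {e} f y r F ρf ρy r≢ r> joins = record
  { parent = par
  ; edges = λ {e′} m → newEdge e′ (∈-++⁻ mk m)
  ; touched = λ {x} → newTouched {x}
  ; decreasing = λ {x} → newDecreasing {x}
  }
  where
  open Forest F
  par : Fin n → Maybe (Fin n)
  par k with k Fin.≟ f
  ... | yes _ = just y
  ... | no _ = parent k
  par-f : par f ≡ just y
  par-f with f Fin.≟ f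
  ... | yes _ = refl
  ... | no ne = ⊥-elim (ne refl)
  par-old : ∀ {k z} → parent k ≡ just z → par k ≡ just z
  par-old {k} p with k Fin.≟ f
  ... | yes refl = ⊥-elim (proj₁ (touched p) ρf)
  ... | no _ = p
  newEdge : ∀ e′ → e′ ∈ mk ⊎ e′ ∈ e ∷ [] → par (proj₁ (proj₁ e′)) ≡ just (proj₂ (proj₁ e′)) ⊎ par (proj₂ (proj₁ e′)) ≡ just (proj₁ (proj₁ e′))
  newEdge e′ (inj₁ m) with edges m
  ... | inj₁ p = inj₁ (par-old p)
  ... | inj₂ p = inj₂ (par-old p)
  newEdge e′ (inj₂ (here refl)) = joined joins
    where
    joined : ∀ {p : Fin n × Fin n} → p ≡ (f , y) ⊎ p ≡ (y , f) →
      par (proj₁ p) ≡ just (proj₂ p) ⊎ par (proj₂ p) ≡ just (proj₁ p)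
    joined (inj₁ refl) = inj₁ par-f
    joined (inj₂ refl) = inj₂ par-f
  newTouched : ∀ {x z} → par x ≡ just z → (ρ [ f ≔ r ]) x ≢ fresh × (ρ [ f ≔ r ]) z ≢ fresh
  newTouched {x} {z} p with x Fin.≟ f
  newTouched p | yes refl with refl ← p = r≢ , λ q → ρy (trans (sym (≔-touched ρ ρf ρy)) q)
  ... | no _ = proj₁ (touched p) , λ q → proj₂ (touched p) (trans (sym (≔-touched ρ ρf (proj₂ (touched p)))) q)
  newDecreasing : ∀ {x z} → par x ≡ just z → rankOf ((ρ [ f ≔ r ]) z) < rankOf ((ρ [ f ≔ r ]) x)
  newDecreasing {x} {z} p with x Fin.≟ f
  newDecreasing p | yes refl with refl ← p = subst (λ s → rankOf s < rankOf r) (sym (≔-touched ρ ρf ρy)) r>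
  ... | no _ = subst (λ s → rankOf s < rankOf (ρ x)) (sym (≔-touched ρ ρf (proj₂ (touched p)))) (decreasing p)

forest-wins : ∀ {mk} {ρ : Roles n} → Forest mk ρ → BreakerWins mk
forest-wins {mk = mk} {ρ} F = Ranked.no-long-path parent (rankOf ∘ ρ) (edge mk edges) decreasing bounded
  where
  open Forest F
  edge : ∀ mk → (∀ {e} → e ∈ mk → parent (proj₁ (proj₁ e)) ≡ just (proj₂ (proj₁ e)) ⊎ parent (proj₂ (proj₁ e)) ≡ just (proj₁ (proj₁ e))) →
    ∀ {x y} → graphOf mk x y → parent x ≡ just y ⊎ parent y ≡ just x
  edge (e ∷ mk) h (here (inj₁ refl)) = h (here refl)
  edge (e ∷ mk) h (here (inj₂ refl)) with h (here refl)
  ... | inj₁ p = inj₂ p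
  ... | inj₂ p = inj₁ p
  edge (e ∷ mk) h (there g) = edge mk (h ∘ there) g
  bounded : ∀ x → rankOf (ρ x) ≤ 3
  bounded x with ρ x
  ... | fresh = z≤n
  ... | hub = z≤n
  ... | rim = s≤s z≤n
  ... | leaf = s≤s (s≤s z≤n)
  ... | twig = s≤s (s≤s (s≤s z≤n))

-- Losing probabilities

ι : ℕ → ℚ
ι zero = 0ℚ
ι (suc n) = 1ℚ ℚ.+ ι n

ι-+ : ∀ m n → ι (m ℕ.+ n) ≡ ι m ℚ.+ ι n
ι-+ zero n = sym (ℚₚ.+-identityˡ _)
ι-+ (suc m) n = trans (cong (1ℚ ℚ.+_) (ι-+ m n)) (sym (ℚₚ.+-assoc 1ℚ (ι m) (ι n)))

ι-* : ∀ m n → ι (m ℕ.* n) ≡ ι m ℚ.* ι n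
ι-* zero n = sym (ℚₚ.*-zeroˡ (ι n))
ι-* (suc m) n = trans (ι-+ n (m ℕ.* n)) (trans (cong₂ ℚ._+_ (sym (ℚₚ.*-identityˡ (ι n))) (ι-* m n))
  (sym (ℚₚ.*-distribʳ-+ (ι n) 1ℚ (ι m))))

ι-nonneg : ∀ n → 0ℚ ℚ.≤ ι n
ι-nonneg zero = ℚₚ.≤-refl
ι-nonneg (suc n) = ℚₚ.+-mono-≤ {0ℚ} {1ℚ} (ℚ.*≤* (ℤ.+≤+ ℕ.z≤n)) (ι-nonneg n)

ι-mono : ∀ {m n} → m ℕ.≤ n → ι m ℚ.≤ ι n
ι-mono {n = n} ℕ.z≤n = ι-nonneg n
ι-mono (ℕ.s≤s p) = ℚₚ.+-monoʳ-≤ 1ℚ (ι-mono p)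

*-mono-nonneg : ∀ {p q} r → 0ℚ ℚ.≤ r → p ℚ.≤ q → p ℚ.* r ℚ.≤ q ℚ.* r
*-mono-nonneg r 0≤r = ℚₚ.*-monoʳ-≤-nonNeg r {{ℚ.nonNegative 0≤r}}

*-nonneg : ∀ {p q} → 0ℚ ℚ.≤ p → 0ℚ ℚ.≤ q → 0ℚ ℚ.≤ p ℚ.* q
*-nonneg {p} {q} 0≤p 0≤q = subst (ℚ._≤ p ℚ.* q) (ℚₚ.*-zeroˡ q) (*-mono-nonneg q 0≤q 0≤p)

/-suc : ∀ k D → ℤ.+ 1 ℚ./ suc D ℚ.+ ℤ.+ k ℚ./ suc D ≡ ℤ.+ suc k ℚ./ suc D
/-suc k D = ℚₚ.toℚᵘ-injective (begin
    toℚᵘ (ℚ.fromℚᵘ p ℚ.+ ℚ.fromℚᵘ q) ≈⟨ ℚₚ.toℚᵘ-homo-+ (ℚ.fromℚᵘ p) (ℚ.fromℚᵘ q) ⟩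
    toℚᵘ (ℚ.fromℚᵘ p) ℚᵘ.+ toℚᵘ (ℚ.fromℚᵘ q) ≈⟨ ℚᵘₚ.+-cong (ℚₚ.toℚᵘ-fromℚᵘ p) (ℚₚ.toℚᵘ-fromℚᵘ q) ⟩
    p ℚᵘ.+ q ≈⟨ *≡* (crossed (ℤ.+ k) (ℤ.+ suc D)) ⟩
    mkℚᵘ (ℤ.+ suc k) D ≈⟨ ℚᵘₚ.≃-sym (ℚₚ.toℚᵘ-fromℚᵘ (mkℚᵘ (ℤ.+ suc k) D)) ⟩
    toℚᵘ (ℚ.fromℚᵘ (mkℚᵘ (ℤ.+ suc k) D)) ∎)
  where
  open import Relation.Binary.Reasoning.Setoid ℚᵘₚ.≃-setoid
  p = mkℚᵘ (ℤ.+ 1) D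
  q = mkℚᵘ (ℤ.+ k) D
  crossed : ∀ k d → ((ℤ.+ 1) ℤ.* d ℤ.+ k ℤ.* d) ℤ.* d ≡ ((ℤ.+ 1) ℤ.+ k) ℤ.* (d ℤ.* d)
  crossed = ℤ-solve-∀

ι-/ : ∀ k D → ι k ℚ.* (ℤ.+ 1 ℚ./ suc D) ≡ ℤ.+ k ℚ./ suc D
ι-/ zero D = trans (ℚₚ.*-zeroˡ (ℤ.+ 1 ℚ./ suc D)) (ℚₚ.fromℚᵘ-cong {mkℚᵘ (ℤ.+ 0) 0} {mkℚᵘ (ℤ.+ 0) D} (*≡* refl))
ι-/ (suc k) D = trans (ℚₚ.*-distribʳ-+ (ℤ.+ 1 ℚ./ suc D) 1ℚ (ι k))
  (trans (cong₂ ℚ._+_ (ℚₚ.*-identityˡ (ℤ.+ 1 ℚ./ suc D)) (ι-/ k D)) (/-suc k D))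

ι-inverse : ∀ D → ι (suc D) ℚ.* (ℤ.+ 1 ℚ./ suc D) ≡ 1ℚ
ι-inverse D = trans (ι-/ (suc D) D)
  (ℚₚ.fromℚᵘ-cong {mkℚᵘ (ℤ.+ suc D) D} {mkℚᵘ (ℤ.+ 1) 0} (*≡* (ℤₚ.*-comm (ℤ.+ suc D) (ℤ.+ 1))))

/-nonneg : ∀ k D → 0ℚ ℚ.≤ ℤ.+ k ℚ./ suc D
/-nonneg k D = subst (0ℚ ℚ.≤_) (ι-/ k D) (*-nonneg (ι-nonneg k)
  (ℚₚ.nonNegative⁻¹ (ℤ.+ 1 ℚ./ suc D) {{ℚₚ.normalize-nonNeg 1 (suc D)}}))

-- A positive rational is at least the reciprocal of its denominator.
/-≤-positive : ∀ k D ε → 0ℚ ℚ.< ε → k ℕ.* ↧ₙ ε ℕ.≤ suc D → ℤ.+ k ℚ./ suc D ℚ.≤ ε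
/-≤-positive k D ε@(mkℚ ℤ.+[1+ p ] d _) 0<ε h = ℚₚ.toℚᵘ-cancel-≤ (ℚᵘₚ.≤-respˡ-≃
  (ℚᵘₚ.≃-sym (ℚₚ.toℚᵘ-fromℚᵘ (mkℚᵘ (ℤ.+ k) D)))
  (*≤* (subst₂ ℤ._≤_ (ℤₚ.pos-* k (suc d)) (ℤₚ.pos-* (suc p) (suc D))
    (ℤ.+≤+ (ℕₚ.≤-trans h (ℕₚ.m≤m+n (suc D) (p ℕ.* suc D)))))))
/-≤-positive k D (mkℚ (ℤ.+ 0) d _) (ℚ.*<* (ℤ.+<+ ())) h
/-≤-positive k D (mkℚ (ℤ.-[1+ p ]) d _) (ℚ.*<* ()) h

*-zero² : ∀ w d → w ℚ.* (0ℚ ℚ.* d) ≡ 0ℚ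
*-zero² w d = trans (cong (w ℚ.*_) (ℚₚ.*-zeroˡ d)) (ℚₚ.*-zeroʳ w)

accumulate : ∀ l w q₁ q₂ a b d → w ℚ.≤ q₁ ℚ.+ w ℚ.* (a ℚ.* d) → l ℚ.* w ℚ.≤ q₂ ℚ.+ w ℚ.* (b ℚ.* d) →
  (1ℚ ℚ.+ l) ℚ.* w ℚ.≤ q₁ ℚ.+ q₂ ℚ.+ w ℚ.* ((a ℚ.+ b) ℚ.* d)
accumulate l w q₁ q₂ a b d h₁ h₂ = subst₂ ℚ._≤_ lhs rhs (ℚₚ.+-mono-≤ h₁ h₂)
  where
  lhs : w ℚ.+ l ℚ.* w ≡ (1ℚ ℚ.+ l) ℚ.* w
  lhs = trans (cong (ℚ._+ l ℚ.* w) (sym (ℚₚ.*-identityˡ w))) (sym (ℚₚ.*-distribʳ-+ w 1ℚ l))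
  rhs : (q₁ ℚ.+ w ℚ.* (a ℚ.* d)) ℚ.+ (q₂ ℚ.+ w ℚ.* (b ℚ.* d)) ≡ q₁ ℚ.+ q₂ ℚ.+ w ℚ.* ((a ℚ.+ b) ℚ.* d)
  rhs = trans (interchange q₁ (w ℚ.* (a ℚ.* d)) q₂ (w ℚ.* (b ℚ.* d))) (cong (q₁ ℚ.+ q₂ ℚ.+_)
    (trans (sym (ℚₚ.*-distribˡ-+ w (a ℚ.* d) (b ℚ.* d))) (cong (w ℚ.*_) (sym (ℚₚ.*-distribʳ-+ d a b)))))

regroup : ∀ w l a d → w ℚ.* ((l ℚ.* a) ℚ.* d) ≡ (l ℚ.* w) ℚ.* (a ℚ.* d)
regroup w l a d = trans (cong (w ℚ.*_) (ℚₚ.*-assoc l a d))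
  (trans (sym (ℚₚ.*-assoc w l (a ℚ.* d))) (cong (ℚ._* (a ℚ.* d)) (ℚₚ.*-comm w l)))

cancel-reciprocal : ∀ w l r → l ℚ.* r ≡ 1ℚ → l ℚ.* (w ℚ.* r) ≡ w
cancel-reciprocal w l r e = trans (ℚₚ.*-comm l (w ℚ.* r)) (trans (ℚₚ.*-assoc w r l)
  (trans (cong (w ℚ.*_) (trans (ℚₚ.*-comm r l) e)) (ℚₚ.*-identityʳ w)))

cancel-minus : ∀ q e → q ℚ.+ e ℚ.- e ≡ q
cancel-minus q e = trans (ℚₚ.+-assoc q e (ℚ.- e)) (trans (cong (q ℚ.+_) (ℚₚ.+-inverseʳ e)) (ℚₚ.+-identityʳ q))

reciprocal-inverse : ∀ l .{{_ : NonZero l}} → ι l ℚ.* (ℤ.+ 1 ℚ./ l) ≡ 1ℚ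
reciprocal-inverse (suc l) = ι-inverse l

reciprocal-nonneg : ∀ l .{{_ : NonZero l}} → 0ℚ ℚ.≤ ℤ.+ 1 ℚ./ l
reciprocal-nonneg (suc l) = /-nonneg 1 l

module _ {A : Set} {P : A → Set} where

  covers-none : ∀ xs → Covers P xs 0ℚ
  covers-none [] = nil
  covers-none ((w , a) ∷ xs) = skip (covers-none xs)

  covers-++ : ∀ {xs ys p q} → Covers P xs p → Covers P ys q → Covers P (xs ++ ys) (p ℚ.+ q)
  covers-++ {ys = ys} {q = q} nil c = subst (Covers P ys) (sym (ℚₚ.+-identityˡ q)) c
  covers-++ {ys = ys} {q = q} (take {w} {xs = xs} {q = q′} pa c) c′ =
    subst (Covers P ((w , _) ∷ xs ++ ys)) (sym (ℚₚ.+-assoc w q′ q)) (take pa (covers-++ c c′))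
  covers-++ (skip c) c′ = skip (covers-++ c c′)

-- The leaves won by Breaker weigh at least w (1 - a / (D + 1)), stated without
-- subtraction.
module Losing {n : ℕ} (s : BreakerStrategy n) (D : ℕ) where

  δ : ℚ
  δ = ℤ.+ 1 ℚ./ suc D

  -- The weight is arbitrary because `play` carries along the probability of the branch so far.
  LosesAtMost : ℕ → (maker breaker unclaimed : List (Edge n)) → ℕ → Set
  LosesAtMost f mk br u a = ∀ w → 0ℚ ℚ.≤ w →
    ∃ λ q → Covers BreakerWins (play s f mk br u w) q × w ℚ.≤ q ℚ.+ w ℚ.* (ι a ℚ.* δ)

  0≤δ : 0ℚ ℚ.≤ δ
  0≤δ = /-nonneg 1 D

  loss-mono : ∀ {w} a b → 0ℚ ℚ.≤ w → a ℕ.≤ b → w ℚ.* (ι a ℚ.* δ) ℚ.≤ w ℚ.* (ι b ℚ.* δ)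
  loss-mono {w} a b 0≤w a≤b = subst₂ ℚ._≤_ (ℚₚ.*-comm (ι a ℚ.* δ) w) (ℚₚ.*-comm (ι b ℚ.* δ) w)
    (*-mono-nonneg w 0≤w (*-mono-nonneg δ 0≤δ (ι-mono a≤b)))

  loses-mono : ∀ {f mk br u a a′} → a ℕ.≤ a′ → LosesAtMost f mk br u a → LosesAtMost f mk br u a′
  loses-mono {a = a} {a′} a≤a′ loses w 0≤w with loses w 0≤w
  ... | q , c , h = q , c , ℚₚ.≤-trans h (ℚₚ.+-monoʳ-≤ q (loss-mono a a′ 0≤w a≤a′))

  -- A losing bound of 1 or more holds with no leaf covered, so a bad position needs no further
  -- analysis.
  loses-certain : ∀ {f mk br u a} → suc D ℕ.≤ a → LosesAtMost f mk br u a
  loses-certain {f} {mk} {br} {u} {a} D≤a w 0≤w = 0ℚ , covers-none (play s f mk br u w) ,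
    subst₂ ℚ._≤_
      (trans (cong (w ℚ.*_) (ι-inverse D)) (ℚₚ.*-identityʳ w))
      (sym (ℚₚ.+-identityˡ (w ℚ.* (ι a ℚ.* δ)))) (loss-mono (suc D) a 0≤w D≤a)

  loses-never : ∀ {f mk br} → BreakerWins mk → LosesAtMost f mk br [] 0
  loses-never {f} {mk} {br} win w 0≤w = w ℚ.+ 0ℚ , covered f ,
    ℚₚ.≤-reflexive (trans (sym (ℚₚ.+-identityʳ w)) (trans (cong (ℚ._+ 0ℚ) (sym (ℚₚ.+-identityʳ w)))
      (cong (w ℚ.+ 0ℚ ℚ.+_) (sym (*-zero² w δ)))))
    where
    covered : ∀ f → Covers BreakerWins (play s f mk br [] w) (w ℚ.+ 0ℚ)
    covered zero = take win nil
    covered (suc f) = take win nil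

  Bounded : ℚ → ℕ → ℕ → ℚ → Set
  Bounded w l a q = ι l ℚ.* w ℚ.≤ q ℚ.+ w ℚ.* (ι a ℚ.* δ)

  concat-bounded : ∀ {X : Set} (h : X → List (ℚ × List (Edge n))) (α : X → ℕ) w ps →
    (∀ {p} → p ∈ ps → ∃ λ q → Covers BreakerWins (h p) q × w ℚ.≤ q ℚ.+ w ℚ.* (ι (α p) ℚ.* δ)) →
    ∃ λ q → Covers BreakerWins (concatMap h ps) q × Bounded w (length ps) (∑ ps α) q
  concat-bounded h α w [] _ = 0ℚ , nil , ℚₚ.≤-reflexive (trans (ℚₚ.*-zeroˡ w)
    (sym (trans (ℚₚ.+-identityˡ (w ℚ.* (0ℚ ℚ.* δ))) (*-zero² w δ))))
  concat-bounded h α w (p ∷ ps) each with each (here refl) | concat-bounded h α w ps (each ∘ there)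
  ... | q₁ , c₁ , h₁ | q₂ , c₂ , h₂ = q₁ ℚ.+ q₂ , covers-++ c₁ c₂ ,
    subst (λ z → (1ℚ ℚ.+ ι (length ps)) ℚ.* w ℚ.≤ q₁ ℚ.+ q₂ ℚ.+ w ℚ.* (z ℚ.* δ))
      (sym (ι-+ (α p) (∑ ps α)))
      (accumulate (ι (length ps)) w q₁ q₂ (ι (α p)) (ι (∑ ps α)) δ h₁ h₂)

  average : ∀ {X : Set} {ps : List X} {α : X → ℕ} {w w′ l a q} → 0ℚ ℚ.≤ w′ → ι l ℚ.* w′ ≡ w → length ps ≡ l →
    ∑ ps α ℕ.≤ l ℕ.* a → Bounded w′ (length ps) (∑ ps α) q → w ℚ.≤ q ℚ.+ w ℚ.* (ι a ℚ.* δ)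
  average {ps = ps} {α} {w} {w′} {l} {a} {q} 0≤w′ total len drop h = ℚₚ.≤-trans
    (subst (ℚ._≤ q ℚ.+ w′ ℚ.* (ι (∑ ps α) ℚ.* δ)) (trans (cong (λ l → ι l ℚ.* w′) len) total) h)
    (ℚₚ.+-monoʳ-≤ q (ℚₚ.≤-trans (loss-mono (∑ ps α) (l ℕ.* a) 0≤w′ drop)
      (ℚₚ.≤-reflexive (trans (cong (λ z → w′ ℚ.* (z ℚ.* δ)) (ι-* l a))
        (trans (regroup w′ (ι l) (ι a) δ) (cong (ℚ._* (ι a ℚ.* δ)) total))))))

  -- The supermartingale step. The bound `α` depends only on the edge taken, so the average over
  -- `picks` is a sum over unclaimed edges, to which edge counts apply.
  loses-step : ∀ {f mk br u a} (α : Edge n → ℕ) → 0 ℕ.< length u →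
    (∀ {e rest} → (e , rest) ∈ picks u →
      let mk′ = mk ++ e ∷ [] ; sp = split rest (s mk′ br rest) in
      LosesAtMost f mk′ (br ++ proj₁ sp) (proj₂ sp) (α e)) →
    ∑ u α ℕ.≤ length u ℕ.* a → LosesAtMost (suc f) mk br u a
  loses-step {u = u@(_ ∷ _)} {a} α _ next drop w 0≤w =
    let 0≤w′ = *-nonneg 0≤w (reciprocal-nonneg (length u))
        q , c , h = concat-bounded _ (α ∘ proj₁) _ (picks u) λ p → next p _ 0≤w′
    in q , c , average {ps = picks u} {α ∘ proj₁} {a = a} {q} 0≤w′
         (cancel-reciprocal w (ι (length u)) _ (reciprocal-inverse (length u)))
         (trans (sym (∑-one (picks u))) (trans (∑-picks u (λ _ → 1)) (∑-one u)))
         (subst (ℕ._≤ length u ℕ.* a) (sym (∑-picks u α)) drop) h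

  winning-probability : ∀ {f mk br u a} ε → 0ℚ ℚ.< ε → a ℕ.* ↧ₙ ε ℕ.≤ suc D → LosesAtMost f mk br u a →
    ProbAtLeast (play s f mk br u 1ℚ) BreakerWins (1ℚ ℚ.- ε)
  winning-probability {a = a} ε 0<ε h loses with loses 1ℚ (ℚ.*≤* (ℤ.+≤+ ℕ.z≤n))
  ... | q , c , 1≤ = q , c , subst (1ℚ ℚ.- ε ℚ.≤_) (cancel-minus q ε)
    (ℚₚ.+-monoˡ-≤ (ℚ.- ε) (ℚₚ.≤-trans 1≤ (ℚₚ.+-monoʳ-≤ q
      (subst (ℚ._≤ ε) (sym (trans (ℚₚ.*-identityˡ (ι a ℚ.* δ)) (ι-/ a D))) (/-≤-positive a D ε 0<ε h)))))

-- One round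

-- The case `none` keeps only the priority 0, enough to exclude it whenever no edge between touched
-- vertices is left.
data Move (ρ : Roles n) (e : Edge n) : Set where
  both : let i = proj₁ (proj₁ e) ; j = proj₂ (proj₁ e) in
    ρ i ≡ fresh → ρ j ≡ fresh → step-roles ρ e ≡ (ρ [ i ≔ hub ]) [ j ≔ rim ] → Move ρ e
  one : ∀ f y → proj₁ e ≡ (f , y) ⊎ proj₁ e ≡ (y , f) → ρ f ≡ fresh → ρ y ≢ fresh →
    step-roles ρ e ≡ ρ [ f ≔ child (ρ y) ] → edgePriority ρ e ≡ level (ρ y) → Move ρ e
  none : edgePriority ρ e ≡ 0 → Move ρ e

move : (ρ : Roles n) (e : Edge n) → Move ρ e
move ρ e@((i , j) , i<j) = view (ρ i) (ρ j) refl refl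
  where
  view : ∀ r s → ρ i ≡ r → ρ j ≡ s → Move ρ e
  first : ∀ s → ρ i ≡ fresh → ρ j ≡ s → s ≢ fresh →
    (step-roles ρ e ≡ ρ [ i ≔ child s ]) → Move ρ e
  first s p q s≢ eq = one i j (inj₁ refl) p (λ z → s≢ (trans (sym q) z))
    (trans eq (cong (λ z → ρ [ i ≔ child z ]) (sym q)))
    (cong (λ z → priority z (ρ j)) p)
  second : ∀ r → ρ i ≡ r → ρ j ≡ fresh → r ≢ fresh →
    (step-roles ρ e ≡ ρ [ j ≔ child r ]) → Move ρ e
  second r p q r≢ eq = one j i (inj₂ refl) q (λ z → r≢ (trans (sym p) z))
    (trans eq (cong (λ z → ρ [ j ≔ child z ]) (sym p)))
    (trans (priority-comm (ρ i) (ρ j)) (cong (λ z → priority z (ρ i)) q))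
  view fresh fresh p q = both p q eq
    where
    eq : step-roles ρ e ≡ (ρ [ i ≔ hub ]) [ j ≔ rim ]
    eq rewrite p | q = refl
  view fresh hub p q = first hub p q (λ ()) eq where
    eq : step-roles ρ e ≡ ρ [ i ≔ leaf ]
    eq rewrite p | q = refl
  view fresh rim p q = first rim p q (λ ()) eq where
    eq : step-roles ρ e ≡ ρ [ i ≔ leaf ]
    eq rewrite p | q = refl
  view fresh leaf p q = first leaf p q (λ ()) eq where
    eq : step-roles ρ e ≡ ρ [ i ≔ twig ]
    eq rewrite p | q = refl
  view fresh twig p q = first twig p q (λ ()) eq where
    eq : step-roles ρ e ≡ ρ [ i ≔ twig ]
    eq rewrite p | q = refl
  view hub fresh p q = second hub p q (λ ()) eq where
    eq : step-roles ρ e ≡ ρ [ j ≔ leaf ]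
    eq rewrite p | q = refl
  view rim fresh p q = second rim p q (λ ()) eq where
    eq : step-roles ρ e ≡ ρ [ j ≔ leaf ]
    eq rewrite p | q = refl
  view leaf fresh p q = second leaf p q (λ ()) eq where
    eq : step-roles ρ e ≡ ρ [ j ≔ twig ]
    eq rewrite p | q = refl
  view twig fresh p q = second twig p q (λ ()) eq where
    eq : step-roles ρ e ≡ ρ [ j ≔ twig ]
    eq rewrite p | q = refl
  view hub hub p q = none (cong₂ priority p q)
  view hub rim p q = none (cong₂ priority p q)
  view hub leaf p q = none (cong₂ priority p q)
  view hub twig p q = none (cong₂ priority p q)
  view rim hub p q = none (cong₂ priority p q)
  view rim rim p q = none (cong₂ priority p q)
  view rim leaf p q = none (cong₂ priority p q)
  view rim twig p q = none (cong₂ priority p q)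
  view leaf hub p q = none (cong₂ priority p q)
  view leaf rim p q = none (cong₂ priority p q)
  view leaf leaf p q = none (cong₂ priority p q)
  view leaf twig p q = none (cong₂ priority p q)
  view twig hub p q = none (cong₂ priority p q)
  view twig rim p q = none (cong₂ priority p q)
  view twig leaf p q = none (cong₂ priority p q)
  view twig twig p q = none (cong₂ priority p q)

record Position (mk u : List (Edge n)) (x c : ℕ) : Set where
  field
    available : u ≼allEdges
    census : Census (roles mk) x c
    forest : Forest mk (roles mk)

module Reply {n} (mk br : List (Edge n)) {u : List (Edge n)} {e rest} (pick : (e , rest) ∈ picks u) where

  b : ℕ
  b = bias n

  ρ : Roles n
  ρ = roles mk

  mk′ u′ : List (Edge n)
  mk′ = mk ++ e ∷ []
  u′ = proj₂ (split rest (breaker n mk′ br rest))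

  roles-mk′ : roles mk′ ≡ step-roles ρ e
  roles-mk′ = foldl-++ step-roles (λ _ → fresh) mk (e ∷ [])

  rest≤u : ∀ f → ∑ rest f ≤ ∑ u f
  rest≤u f = ≤-trans (m≤n+m _ (f e)) (≤-reflexive (picks-∑ pick f))

  e≤u : ∀ f → f e ≤ ∑ u f
  e≤u f = ≤-trans (m≤m+n (f e) _) (≤-reflexive (picks-∑ pick f))

  present : ∀ j → edgePriority ρ e ≤ j → 1 ≤ count≤ j ρ u
  present j p = ≤-trans (≤-reflexive (sym (Greedy.⟦≤ᵇ⟧-yes (edgePriority ρ) p)))
    (e≤u λ e → ⟦ edgePriority ρ e ≤ᵇ j ⟧)

  absent : ∀ j {A : Set} → count≤ j ρ u ≤ 0 → edgePriority ρ e ≤ j → A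
  absent j h p = ⊥-elim (<⇒≱ (present j p) h)

  available′ : u ≼allEdges → u′ ≼allEdges
  available′ u≼ f = ≤-trans (m≤n+m _ (∑ (proj₁ (split rest (breaker n mk′ br rest))) f))
    (≤-trans (≤-reflexive (split-∑ rest (breaker n mk′ br rest) f)) (≤-trans (rest≤u f) (u≼ f)))

  length-u′ : length u′ ≡ length u ∸ suc b
  length-u′ = trans (Greedy.greedy-length (edgePriority (roles mk′)) b rest)
    (trans (cong (_∸ suc b) length-rest) refl)
    where
    length-rest : suc (length rest) ≡ length u
    length-rest = trans (cong suc (sym (∑-one rest))) (trans (picks-∑ pick (λ _ → 1)) (∑-one u))

  count-reply : ∀ {ρ′} j k → step-roles ρ e ≡ ρ′ → count≤ j ρ′ rest ≤ k → count≤ j (roles mk′) u′ ≤ k ∸ b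
  count-reply j k refl h = ≤-trans
    (≤-reflexive (Greedy.greedy-count≤ (edgePriority (roles mk′)) j b rest))
    (∸-monoˡ-≤ b (subst (λ ρ → count≤ j ρ rest ≤ k) (sym roles-mk′) h))

  module _ {x c} (P : Position mk u x c) where
    open Position P
    open Census census

    rest≼ : rest ≼allEdges
    rest≼ f = ≤-trans (rest≤u f) (available f)

    reply-bound : ∀ j f r w {k} → step-roles ρ e ≡ ρ [ f ≔ r ] → ρ f ≡ fresh →
      (∀ s → gain j r s ≤ gain j fresh s + w s) → card (w ∘ ρ) ≡ k →
      count≤ j (roles mk′) u′ ≤ count≤ j ρ u + k ∸ b
    reply-bound j f r w eq ρf g refl = count-reply j _ eq
      (≤-trans (count-update j {rest} ρ r w rest≼ ρf g) (+-monoˡ-≤ _ (rest≤u _)))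

    card-open : card (isOpen ∘ ρ) ≡ n ∸ (x + c)
    card-open = trans (∑-+ (allFin n) _ _) (trans (cong (_+ card (isFresh ∘ ρ)) hubs)
      (trans (sym (m+n∸n≡m _ (x + c))) (cong (_∸ (x + c)) (trans (arrange c _ x) freshes))))
      where
      arrange : ∀ c f x → c + f + (x + c) ≡ f + (x + 2 * c)
      arrange = solve-∀

    module One f y (joins : proj₁ e ≡ (f , y) ⊎ proj₁ e ≡ (y , f)) (ρf : ρ f ≡ fresh) (ρy : ρ y ≢ fresh)
      (eq : step-roles ρ e ≡ ρ [ f ≔ child (ρ y) ]) where

      position : ρ y ≢ twig → Position mk′ u′ (suc x) c
      position ρy≢twig = record
        { available = available′ available
        ; census = subst (λ ρ → Census ρ (suc x) c) (sym (trans roles-mk′ eq))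
            (census-attach (child (ρ y)) census ρf (isHub-child (ρ y)) (isTouched-child (ρ y)) (isFresh-child (ρ y)))
        ; forest = subst (Forest mk′) (sym (trans roles-mk′ eq))
            (forest-attach f y (child (ρ y)) forest ρf ρy (child≢fresh (ρ y)) (rank-child (ρ y) ρy≢twig) joins)
        }
        where
        isHub-child : ∀ r → isHub (child r) ≡ 0
        isHub-child fresh = refl
        isHub-child hub = refl
        isHub-child rim = refl
        isHub-child leaf = refl
        isHub-child twig = refl
        isTouched-child : ∀ r → isTouched (child r) ≡ 1
        isTouched-child fresh = refl
        isTouched-child hub = refl
        isTouched-child rim = refl
        isTouched-child leaf = refl
        isTouched-child twig = refl
        isFresh-child : ∀ r → isFresh (child r) ≡ 0
        isFresh-child fresh = refl
        isFresh-child hub = refl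
        isFresh-child rim = refl
        isFresh-child leaf = refl
        isFresh-child twig = refl
        child≢fresh : ∀ r → child r ≢ fresh
        child≢fresh fresh ()
        child≢fresh hub ()
        child≢fresh rim ()
        child≢fresh leaf ()
        child≢fresh twig ()
        rank-child : ∀ r → r ≢ twig → rankOf r < rankOf (child r)
        rank-child fresh _ = s≤s z≤n
        rank-child hub _ = s≤s z≤n
        rank-child rim _ = s≤s (s≤s z≤n)
        rank-child leaf _ = s≤s (s≤s (s≤s z≤n))
        rank-child twig ne = ⊥-elim (ne refl)

      count₀ : count≤ 0 (roles mk′) u′ ≤ count≤ 0 ρ u + (x + 2 * c) ∸ b
      count₀ = reply-bound 0 f _ isTouched eq ρf (bound (ρ y)) touched
        where
        bound : ∀ r s → gain 0 (child r) s ≤ gain 0 fresh s + isTouched s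
        bound leaf = role-≤ (gain 0 twig) _
        bound twig = role-≤ (gain 0 twig) _
        bound fresh = role-≤ (gain 0 leaf) _
        bound hub = role-≤ (gain 0 leaf) _
        bound rim = role-≤ (gain 0 leaf) _

      -- The edges from a leaf to fresh vertices have priority 2, so only those to touched vertices
      -- enter.
      count₁ : child (ρ y) ≡ leaf → count≤ 1 (roles mk′) u′ ≤ count≤ 1 ρ u + (x + 2 * c) ∸ b
      count₁ e = reply-bound 1 f _ isTouched eq ρf
        (subst (λ r → ∀ s → gain 1 r s ≤ gain 1 fresh s + isTouched s) (sym e) (role-≤ (gain 1 leaf) _)) touched

      count₁₂ : ∀ j → count≤ j (roles mk′) u′ ≤ count≤ j ρ u + n ∸ b
      count₁₂ j = reply-bound j f _ (λ _ → 1) eq ρf (λ s → ≤-trans (bound (priority (child (ρ y)) s ≤ᵇ j)) (m≤n+m 1 _)) (card-1 n)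
        where
        bound : ∀ c → ⟦ c ⟧ ≤ 1
        bound true = ≤-refl
        bound false = z≤n

      -- Edges from `f` to rims, leaves and twigs were already counted while `f` was fresh; those to
      -- hubs and fresh vertices are new.
      count₃ : count≤ 3 (roles mk′) u′ ≤ count≤ 3 ρ u + (n ∸ (x + c)) ∸ b
      count₃ = reply-bound 3 f _ isOpen eq ρf (bound (ρ y)) card-open
        where
        bound : ∀ r s → gain 3 (child r) s ≤ gain 3 fresh s + isOpen s
        bound leaf = role-≤ (gain 3 twig) _
        bound twig = role-≤ (gain 3 twig) _
        bound fresh = role-≤ (gain 3 leaf) _
        bound hub = role-≤ (gain 3 leaf) _
        bound rim = role-≤ (gain 3 leaf) _

    module Both (ρi : ρ (proj₁ (proj₁ e)) ≡ fresh) (ρj : ρ (proj₂ (proj₁ e)) ≡ fresh)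
      (eq : step-roles ρ e ≡ (ρ [ proj₁ (proj₁ e) ≔ hub ]) [ proj₂ (proj₁ e) ≔ rim ]) where

      i j : Fin n
      i = proj₁ (proj₁ e)
      j = proj₂ (proj₁ e)

      i≢j : i ≢ j
      i≢j i≡j = <-irrefl (cong toℕ i≡j) (proj₂ e)

      ρ₁ : Roles n
      ρ₁ = ρ [ i ≔ hub ]

      ρ₁j : ρ₁ j ≡ fresh
      ρ₁j = trans (≔-other ρ (i≢j ∘ sym)) ρj

      ρ₁i : ρ₁ i ≡ hub
      ρ₁i = ≔-same ρ i

      position : Position mk′ u′ x (suc c)
      position = record
        { available = available′ available
        ; census = subst (λ ρ → Census ρ x (suc c)) (sym (trans roles-mk′ eq)) (census-plant census ρi ρj i≢j)
        ; forest = subst (Forest mk′) (sym (trans roles-mk′ eq))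
            (forest-attach j i rim (forest-plant hub forest ρi) ρ₁j (λ q → hub≢fresh (trans (sym ρ₁i) q)) (λ ())
              (subst (λ r → rankOf r < 1) (sym ρ₁i) (s≤s z≤n)) (inj₂ refl))
        }
        where
        hub≢fresh : hub ≢ fresh
        hub≢fresh ()

      both-bound : ∀ k w w₁ {a a₁} → (∀ s → gain k hub s ≤ gain k fresh s + w s) →
        (∀ s → gain k rim s ≤ gain k fresh s + w₁ s) → card (w ∘ ρ) ≡ a → card (w₁ ∘ ρ₁) ≡ a₁ →
        count≤ k (roles mk′) u′ ≤ count≤ k ρ u + (a + a₁) ∸ b
      both-bound k w w₁ {a} {a₁} g g₁ refl refl = count-reply k _ eq (≤-trans (count-update k {rest} ρ₁ rim w₁ rest≼ ρ₁j g₁)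
        (≤-trans (+-monoˡ-≤ _ (≤-trans (count-update k {rest} ρ hub w rest≼ ρi g) (+-monoˡ-≤ _ (rest≤u _))))
          (≤-reflexive (+-assoc (count≤ k ρ u) _ _))))

      touched₁ : card (isTouched ∘ ρ₁) ≡ suc (x + 2 * c)
      touched₁ = trans (sym (+-identityʳ _)) (trans (card-roles isTouched ρ hub ρi) (trans (cong (_+ 1) touched) (+-comm _ 1)))

      open₁ : card (isOpen ∘ ρ₁) ≡ n ∸ (x + c)
      open₁ = trans (+-cancelʳ-≡ 1 _ _ (card-roles isOpen ρ hub ρi)) card-open

      count₀₁₂ : ∀ k → k ≤ 2 → count≤ k (roles mk′) u′ ≤ count≤ k ρ u + (x + 2 * c + suc (x + 2 * c)) ∸ b
      count₀₁₂ 0 _ = both-bound 0 isTouched isTouched (role-≤ (gain 0 hub) _) (role-≤ (gain 0 rim) _) touched touched₁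
      count₀₁₂ 1 _ = both-bound 1 isTouched isTouched (role-≤ (gain 1 hub) _) (role-≤ (gain 1 rim) _) touched touched₁
      count₀₁₂ 2 _ = both-bound 2 isTouched isTouched (role-≤ (gain 2 hub) _) (role-≤ (gain 2 rim) _) touched touched₁
      count₀₁₂ (suc (suc (suc _))) (s≤s (s≤s ()))

      -- Here sparing hubs pays off. The new hub brings in only its edges to the `c` older hubs, as
      -- those to fresh vertices stay at priority 4; the rim brings in its edges to hubs and fresh
      -- vertices. Together this is `n - x`.
      count₃ : count≤ 3 (roles mk′) u′ ≤ count≤ 3 ρ u + (c + (n ∸ (x + c))) ∸ b
      count₃ = both-bound 3 isHub isOpen (role-≤ (gain 3 hub) _) (role-≤ (gain 3 rim) _) hubs open₁

-- Arithmetic of the backlog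

gap : ∀ {a b} k → b ≡ a + k → a ≤ b
gap k refl = m≤m+n _ k

slack : ∀ {a b} → a ≤ b → ∃ λ k → b ≡ a + k
slack a≤b = _ , sym (m+[n∸m]≡n a≤b)

-- The backlog M of edges of priority at most 3, after x edges at one fresh
-- vertex and c edges at two: replies of n - u edges keep 2 M + x² + 2 x c below
-- (2 u + 1) (x + c), unless M vanishes.
Backlog : ℕ → ℕ → ℕ → ℕ → Set
Backlog u M x c = 2 * M + (x * x + 2 * (x * c)) ≤ (2 * u + 1) * (x + c) ⊎ M ≡ 0

-- A move of cost `k = n - v` against replies of `b = n - u` edges changes the backlog by `u - v`,
-- while the quadratic term grows by at most `2 v + 1`; their combination gains at most `2 u + 1`
-- per round. From an empty backlog a positive one can only arise if `v < u`, and then `small`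
-- restores the bound.
backlog-step : ∀ {u M M′ x c k b} v x′ c′ → M′ ≤ M + k ∸ b → k + v ≡ b + u →
  (v < u → x * x + 2 * (x * c) ≤ (2 * u + 1) * (x + c)) →
  x′ * x′ + 2 * (x′ * c′) ≤ x * x + 2 * (x * c) + 2 * v + 1 → x′ + c′ ≡ suc (x + c) →
  Backlog u M x c → Backlog u M′ x′ c′
backlog-step {u} {M} {M′} {x} {c} {k} {b} v x′ c′ M′≤ kv small grow t′ J with M + k ≤? b
... | yes M+k≤b = inj₂ (n≤0⇒n≡0 (≤-trans M′≤ (≤-reflexive (m≤n⇒m∸n≡0 M+k≤b))))
... | no M+k≰b = inj₁ (begin
    2 * M′ + (x′ * x′ + 2 * (x′ * c′))
  ≤⟨ +-monoʳ-≤ (2 * M′) grow ⟩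
    2 * M′ + (x * x + 2 * (x * c) + 2 * v + 1)
  ≡⟨ r₁ M′ v (x * x + 2 * (x * c)) ⟩
    2 * (M′ + v) + (x * x + 2 * (x * c)) + 1
  ≤⟨ +-monoˡ-≤ 1 (+-monoˡ-≤ _ (*-monoʳ-≤ 2 M′+v≤)) ⟩
    2 * (M + u) + (x * x + 2 * (x * c)) + 1
  ≡⟨ r₂ M u (x * x + 2 * (x * c)) ⟩
    2 * M + (x * x + 2 * (x * c)) + (2 * u + 1)
  ≤⟨ +-monoˡ-≤ (2 * u + 1) (bound J) ⟩
    (2 * u + 1) * (x + c) + (2 * u + 1)
  ≡⟨ trans (r₃ (2 * u + 1) (x + c)) (cong ((2 * u + 1) *_) (sym t′)) ⟩
    (2 * u + 1) * (x′ + c′) ∎)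
  where
  open ≤-Reasoning
  r₁ : ∀ M v y → 2 * M + (y + 2 * v + 1) ≡ 2 * (M + v) + y + 1
  r₁ = solve-∀
  r₂ : ∀ M u y → 2 * (M + u) + y + 1 ≡ 2 * M + y + (2 * u + 1)
  r₂ = solve-∀
  r₃ : ∀ a t → a * t + a ≡ a * suc t
  r₃ = solve-∀
  r₄ : ∀ M v b → M + v + b ≡ M + b + v
  r₄ = solve-∀
  r₅ : ∀ M b u → M + (b + u) ≡ M + u + b
  r₅ = solve-∀
  b≤ : b ≤ M + k
  b≤ = ≰⇒≥ M+k≰b
  M′+v≤ : M′ + v ≤ M + u
  M′+v≤ = +-cancelʳ-≤ b _ _ (begin
    M′ + v + b ≡⟨ r₄ M′ v b ⟩
    M′ + b + v ≤⟨ +-monoˡ-≤ v (≤-trans (+-monoˡ-≤ b M′≤) (≤-reflexive (m∸n+n≡m b≤))) ⟩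
    M + k + v ≡⟨ trans (+-assoc M k v) (trans (cong (M +_) kv) (r₅ M b u)) ⟩
    M + u + b ∎)
  bound : Backlog u M x c → 2 * M + (x * x + 2 * (x * c)) ≤ (2 * u + 1) * (x + c)
  bound (inj₁ h) = h
  bound (inj₂ refl) = small (+-cancelˡ-< b v u (subst (b + v <_) kv (+-monoˡ-< v (≰⇒> M+k≰b))))

backlog-both : ∀ {u M M′ x c k b} → M′ ≤ M + k ∸ b → k + x ≡ b + u → Backlog u M x c → Backlog u M′ x (suc c)
backlog-both {u} {M} {M′} {x} {c} {k} {b} h e = backlog-step {u} {M} {M′} {x} {c} {k} {b} x x (suc c) h e small (gap 1 (r x c)) (+-suc x c)
  where
  r : ∀ x c → x * x + 2 * (x * c) + 2 * x + 1 ≡ x * x + 2 * (x * suc c) + 1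
  r = solve-∀
  s : ∀ x c → (2 * x + 1) * (x + c) ≡ x * x + 2 * (x * c) + (x * x + x + c)
  s = solve-∀
  small : x < u → x * x + 2 * (x * c) ≤ (2 * u + 1) * (x + c)
  small x<u = ≤-trans (gap (x * x + x + c) (s x c))
    (*-monoˡ-≤ (x + c) (+-monoˡ-≤ 1 (*-monoʳ-≤ 2 (<⇒≤ x<u))))

backlog-one : ∀ {u M M′ x c k b} → M′ ≤ M + k ∸ b → k + (x + c) ≡ b + u → Backlog u M x c → Backlog u M′ (suc x) c
backlog-one {u} {M} {M′} {x} {c} {k} {b} h e = backlog-step {u} {M} {M′} {x} {c} {k} {b} (x + c) (suc x) c h e small (≤-reflexive (r x c)) refl
  where
  r : ∀ x c → suc x * suc x + 2 * (suc x * c) ≡ x * x + 2 * (x * c) + 2 * (x + c) + 1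
  r = solve-∀
  s : ∀ x c → (2 * (x + c) + 1) * (x + c) ≡
    x * x + 2 * (x * c) + (x * x + 2 * (x * c) + 2 * (c * c) + x + c)
  s = solve-∀
  small : x + c < u → x * x + 2 * (x * c) ≤ (2 * u + 1) * (x + c)
  small t<u = ≤-trans (gap (x * x + 2 * (x * c) + 2 * (c * c) + x + c) (s x c))
    (*-monoˡ-≤ (x + c) (+-monoˡ-≤ 1 (*-monoʳ-≤ 2 (<⇒≤ t<u))))

backlog-bound : ∀ {u M x c} → Backlog u M x c → 2 * M ≤ (2 * u + 1) * (x + c)
backlog-bound (inj₁ h) = ≤-trans (m≤m+n _ _) h
backlog-bound (inj₂ refl) = z≤n

-- Otherwise `x (x + 2 c)` would be at most `(20 m + 21) * 180 m`. For `x` up to `20 m + 21` the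
-- second factor is at least `339 m`, and 12 * 339 = 4068 exceeds 21 * 180 = 3780, which explains
-- the target `12 m`. For larger `x` it suffices that the second factor is at least `180 m`.
backlog-cleared : ∀ {u M x c m} → u ≤ 10 * m + 10 → 100 ≤ m → x + c ≡ 180 * m → 12 * m ≤ x →
  Backlog u M x c → M ≡ 0
backlog-cleared _ _ _ _ (inj₂ M≡0) = M≡0
backlog-cleared {u} {M} {x} {c} {m} u≤ m≥ t x≥ (inj₁ h) = ⊥-elim (<⇒≱ large h′)
  where
  h′ : x * x + 2 * (x * c) ≤ (20 * m + 21) * (180 * m)
  h′ = ≤-trans (m≤n+m _ (2 * M)) (≤-trans h (subst (λ z → (2 * u + 1) * (x + c) ≤ (20 * m + 21) * z) t
    (*-monoˡ-≤ (x + c) (≤-trans (+-monoˡ-≤ 1 (*-monoʳ-≤ 2 u≤)) (≤-reflexive (r m))))))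
    where
    r : ∀ m → 2 * (10 * m + 10) + 1 ≡ 20 * m + 21
    r = solve-∀
  open ≤-Reasoning
  21≤m : 21 ≤ m
  21≤m = ≤-trans (≤ᵇ⇒≤ 21 100 _) m≥
  product : x * x + 2 * (x * c) ≡ x * (x + 2 * c)
  product = r x c
    where
    r : ∀ x c → x * x + 2 * (x * c) ≡ x * (x + 2 * c)
    r = solve-∀
  0<t : 0 < 180 * m
  0<t = *-mono-≤ (≤ᵇ⇒≤ 1 180 _) (≤-trans (≤ᵇ⇒≤ 1 21 _) 21≤m)
  large : (20 * m + 21) * (180 * m) < x * x + 2 * (x * c)
  large with x ≤? 20 * m + 21
  ... | yes x≤ = begin-strict
      (20 * m + 21) * (180 * m) ≤⟨ *-monoˡ-≤ (180 * m) (≤-trans (+-monoʳ-≤ (20 * m) 21≤m) (≤-reflexive (r₁ m))) ⟩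
      21 * m * (180 * m) <⟨ m<m+n _ {12 * m * (24 * m)} (*-mono-≤ (*-mono-≤ (≤ᵇ⇒≤ 1 12 _) 1≤m) (*-mono-≤ (≤ᵇ⇒≤ 1 24 _) 1≤m)) ⟩
      21 * m * (180 * m) + 12 * m * (24 * m) ≡⟨ r₂ m ⟩
      12 * m * (339 * m) ≤⟨ *-mono-≤ x≥ 339m≤ ⟩
      x * (x + 2 * c) ≡⟨ sym product ⟩
      x * x + 2 * (x * c) ∎
    where
    1≤m : 1 ≤ m
    1≤m = ≤-trans (≤ᵇ⇒≤ 1 21 _) 21≤m
    r₁ : ∀ m → 20 * m + m ≡ 21 * m
    r₁ = solve-∀
    r₂ : ∀ m → 21 * m * (180 * m) + 12 * m * (24 * m) ≡ 12 * m * (339 * m)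
    r₂ = solve-∀
    r₃ : ∀ m → 339 * m + (21 * m) ≡ 2 * (180 * m)
    r₃ = solve-∀
    r₄ : ∀ x c → 2 * (x + c) ≡ (x + 2 * c) + x
    r₄ = solve-∀
    339m≤ : 339 * m ≤ x + 2 * c
    339m≤ = +-cancelʳ-≤ (21 * m) _ _ (begin
      339 * m + 21 * m ≡⟨ trans (r₃ m) (trans (cong (2 *_) (sym t)) (r₄ x c)) ⟩
      (x + 2 * c) + x ≤⟨ +-monoʳ-≤ (x + 2 * c) (≤-trans x≤ (≤-trans (+-monoʳ-≤ (20 * m) 21≤m) (≤-reflexive (r₁ m)))) ⟩
      (x + 2 * c) + 21 * m ∎)
  ... | no x≰ = begin-strict
      (20 * m + 21) * (180 * m) <⟨ m<n+m _ 0<t ⟩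
      suc (20 * m + 21) * (180 * m) ≤⟨ *-mono-≤ (≰⇒> x≰) (≤-trans (≤-reflexive (sym t)) (+-monoʳ-≤ x (m≤m+n c _))) ⟩
      x * (x + 2 * c) ≡⟨ sym product ⟩
      x * x + 2 * (x * c) ∎

-- Drift of the queue and of the shortfall

queue-both : ∀ {d d′ q u k b} → k + 4 * u ≤ b → d ≤ q * u → d′ ≤ d + k ∸ b → d′ ≤ (q ∸ 4) * u
queue-both {d} {d′} {q} {u} {k} {b} h d≤ d′≤ = begin
    d′ ≤⟨ d′≤ ⟩
    d + k ∸ b ≤⟨ ∸-mono {d + k} {q * u + k} (+-monoˡ-≤ k d≤) h ⟩
    q * u + k ∸ (k + 4 * u) ≡⟨ sym (∸-+-assoc (q * u + k) k (4 * u)) ⟩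
    q * u + k ∸ k ∸ 4 * u ≡⟨ cong (_∸ 4 * u) (m+n∸n≡m (q * u) k) ⟩
    q * u ∸ 4 * u ≡⟨ sym (*-distribʳ-∸ u q 4) ⟩
    (q ∸ 4) * u ∎
  where open ≤-Reasoning

queue-one : ∀ {d d′ q u n b} → n ≡ b + u → d ≤ q * u → d′ ≤ d + n ∸ b → d′ ≤ suc q * u
queue-one {d} {d′} {q} {u} {_} {b} refl d≤ d′≤ = begin
    d′ ≤⟨ d′≤ ⟩
    d + (b + u) ∸ b ≡⟨ cong (_∸ b) (r d b u) ⟩
    d + u + b ∸ b ≡⟨ m+n∸n≡m (d + u) b ⟩
    d + u ≤⟨ +-monoˡ-≤ u d≤ ⟩
    q * u + u ≡⟨ +-comm (q * u) u ⟩
    suc q * u ∎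
  where
  open ≤-Reasoning
  r : ∀ d b u → d + (b + u) ≡ d + u + b
  r = solve-∀

-- The summand 16 covers `q < 4`, where the subtraction truncates. After division by 16 it costs at
-- most one unit per round, repaid by the fall of `r`.
16*2^[q∸4]≤ : ∀ q → 16 * 2 ^ (q ∸ 4) ≤ 2 ^ q + 16
16*2^[q∸4]≤ 0 = ≤ᵇ⇒≤ _ _ _
16*2^[q∸4]≤ 1 = ≤ᵇ⇒≤ _ _ _
16*2^[q∸4]≤ 2 = ≤ᵇ⇒≤ _ _ _
16*2^[q∸4]≤ 3 = ≤ᵇ⇒≤ _ _ _
16*2^[q∸4]≤ (suc (suc (suc (suc q)))) = gap 16 (r (2 ^ q))
  where
  r : ∀ p → 2 * (2 * (2 * (2 * p))) + 16 ≡ 16 * p + 16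
  r = solve-∀

q*[1+q]≤4*2^q : ∀ q → q * suc q ≤ 4 * 2 ^ q
q*[1+q]≤4*2^q zero = z≤n
q*[1+q]≤4*2^q (suc q) = begin
    suc q * suc (suc q) ≡⟨ r₁ q ⟩
    q * suc q + 2 * suc q ≤⟨ +-mono-≤ (q*[1+q]≤4*2^q q) (*-monoʳ-≤ 2 (n<m^n q)) ⟩
    4 * 2 ^ q + 2 * 2 ^ q ≤⟨ gap (2 * 2 ^ q) (r₂ (2 ^ q)) ⟩
    4 * 2 ^ suc q ∎
  where
  open ≤-Reasoning
  r₁ : ∀ q → suc q * suc (suc q) ≡ q * suc q + 2 * suc q
  r₁ = solve-∀
  r₂ : ∀ p → 4 * (2 * p) ≡ 4 * p + 2 * p + 2 * p
  r₂ = solve-∀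
  n<m^n : ∀ q → suc q ≤ 2 ^ q
  n<m^n zero = s≤s z≤n
  n<m^n (suc q) = ≤-trans (+-mono-≤ (m^n>0 2 q) (n<m^n q)) (≤-reflexive (cong (2 ^ q +_) (sym (+-identityʳ _))))

-- Divided by 128, the second hypothesis says that doubling on `O` and division by 16 on `F` keep on
-- average at most 127/128 of `p`. The third says that `4 u² p`, which bounds the expense for newly
-- exposed twigs, fits into the remaining 1/128.
power-drift : ∀ {L F O u p p′ K} → F + O ≡ L → 256 * O + 8 * F ≤ 127 * L → 512 * (u * u) ≤ L →
  16 * p′ ≤ p + 16 → K ≤ 4 * p → F * p′ + O * (2 * p) + u * u * K ≤ L * p + L
power-drift {L} {F} {O} {u} {p} {p′} {K} refl h₁ h₂ h₃ h₄ = *-cancelˡ-≤ 16 (begin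
    16 * (F * p′ + O * (2 * p) + u * u * K)
  ≡⟨ r₁ F O u p p′ K ⟩
    F * (16 * p′) + (32 * O * p + 16 * (u * u) * K)
  ≤⟨ +-mono-≤ (*-monoʳ-≤ F h₃) (+-monoʳ-≤ (32 * O * p) (*-monoʳ-≤ (16 * (u * u)) h₄)) ⟩
    F * (p + 16) + (32 * O * p + 16 * (u * u) * (4 * p))
  ≡⟨ r₂ F O u p ⟩
    (F + 32 * O + 64 * (u * u)) * p + 16 * F
  ≤⟨ +-mono-≤ (*-monoˡ-≤ p weights) (*-monoʳ-≤ 16 (m≤m+n F O)) ⟩
    16 * L * p + 16 * L
  ≡⟨ r₃ L p ⟩
    16 * (L * p + L) ∎)
  where
  open ≤-Reasoning
  r₁ : ∀ F O u p p′ K → 16 * (F * p′ + O * (2 * p) + u * u * K) ≡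
    F * (16 * p′) + (32 * O * p + 16 * (u * u) * K)
  r₁ = solve-∀
  r₂ : ∀ F O u p → F * (p + 16) + (32 * O * p + 16 * (u * u) * (4 * p)) ≡
    (F + 32 * O + 64 * (u * u)) * p + 16 * F
  r₂ = solve-∀
  r₃ : ∀ L p → 16 * L * p + 16 * L ≡ 16 * (L * p + L)
  r₃ = solve-∀
  r₄ : ∀ F O u → 8 * (F + 32 * O + 64 * (u * u)) ≡ 256 * O + 8 * F + 512 * (u * u)
  r₄ = solve-∀
  r₅ : ∀ L → 127 * L + L ≡ 8 * (16 * L)
  r₅ = solve-∀
  weights : F + 32 * O + 64 * (u * u) ≤ 16 * L
  weights = *-cancelˡ-≤ 8 (begin
    8 * (F + 32 * O + 64 * (u * u)) ≡⟨ r₄ F O u ⟩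
    256 * O + 8 * F + 512 * (u * u) ≤⟨ +-mono-≤ h₁ h₂ ⟩
    127 * L + L ≡⟨ r₅ L ⟩
    8 * (16 * L) ∎)

-- At odds 5 : 1 the steps +1 and -5 have mean zero, and more frequent downward steps only help. The
-- allowance 25 bounds the square of either step, and also covers `δ < 5`, where the downward step
-- truncates but `(δ + 1)²` is at most 25.
square-drift : ∀ {F O} δ → F ≤ 5 * O → F * (suc δ * suc δ) + O * ((δ ∸ 5) * (δ ∸ 5)) ≤ (F + O) * (δ * δ + 25)
square-drift {F} {O} δ F≤ with 5 ≤? δ
... | yes 5≤δ = subst (λ δ → F * (suc δ * suc δ) + O * ((δ ∸ 5) * (δ ∸ 5)) ≤ (F + O) * (δ * δ + 25))
        (m+[n∸m]≡n 5≤δ) (large (δ ∸ 5))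
  where
  open ≤-Reasoning
  large : ∀ k → F * (suc (5 + k) * suc (5 + k)) + O * ((5 + k ∸ 5) * (5 + k ∸ 5)) ≤ (F + O) * ((5 + k) * (5 + k) + 25)
  large k = +-cancelʳ-≤ (O * (10 * k)) _ _ (begin
      F * (suc (5 + k) * suc (5 + k)) + O * (k * k) + O * (10 * k)
    ≡⟨ r₂ F O k ⟩
      F * (k * k + 10 * k + 36) + O * (k * k + 10 * k) + 2 * k * F
    ≤⟨ +-mono-≤ (+-monoˡ-≤ _ (*-monoʳ-≤ F (+-monoʳ-≤ (k * k + 10 * k) (≤ᵇ⇒≤ 36 50 _)))) (*-monoʳ-≤ (2 * k) F≤) ⟩
      F * (k * k + 10 * k + 50) + O * (k * k + 10 * k) + 2 * k * (5 * O)
    ≤⟨ gap (50 * O) (r₃ F O k) ⟩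
      (F + O) * ((5 + k) * (5 + k) + 25) + O * (10 * k) ∎)
    where
    r₂ : ∀ F O k → F * ((6 + k) * (6 + k)) + O * (k * k) + O * (10 * k) ≡
      F * (k * k + 10 * k + 36) + O * (k * k + 10 * k) + 2 * k * F
    r₂ = solve-∀
    r₃ : ∀ F O k → (F + O) * ((5 + k) * (5 + k) + 25) + O * (10 * k) ≡
      F * (k * k + 10 * k + 50) + O * (k * k + 10 * k) + 2 * k * (5 * O) + 50 * O
    r₃ = solve-∀
... | no 5≰δ = begin
    F * (suc δ * suc δ) + O * ((δ ∸ 5) * (δ ∸ 5))
  ≡⟨ cong (λ z → F * (suc δ * suc δ) + O * (z * z)) (m≤n⇒m∸n≡0 (<⇒≤ (≰⇒> 5≰δ))) ⟩
    F * (suc δ * suc δ) + O * 0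
  ≡⟨ trans (cong (F * (suc δ * suc δ) +_) (*-zeroʳ O)) (+-identityʳ _) ⟩
    F * (suc δ * suc δ)
  ≤⟨ *-mono-≤ (m≤m+n F O) (≤-trans (*-mono-≤ (≰⇒> 5≰δ) (≰⇒> 5≰δ)) (m≤n+m 25 (δ * δ))) ⟩
    (F + O) * (δ * δ + 25) ∎
  where open ≤-Reasoning

-- The second alternative is the time before `T₀`, when no rate is available but the shortfall is
-- zero after either move.
shortfall-drift : ∀ {L F O r δ δF δO} → F + O ≡ L → (F ≤ 5 * O × δF ≤ suc δ × δO ≤ δ ∸ 5) ⊎ (δF ≡ 0 × δO ≡ 0) →
  F * (δF * δF + 25 * r) + O * (δO * δO + 25 * r) ≤ L * (δ * δ + 25 * suc r)
shortfall-drift {_} {F} {O} {r} {δ} {δF} {δO} refl (inj₁ (F≤ , h , h′)) = begin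
    F * (δF * δF + 25 * r) + O * (δO * δO + 25 * r)
  ≤⟨ +-mono-≤ (*-monoʳ-≤ F (+-monoˡ-≤ (25 * r) (*-mono-≤ h h))) (*-monoʳ-≤ O (+-monoˡ-≤ (25 * r) (*-mono-≤ h′ h′))) ⟩
    F * (suc δ * suc δ + 25 * r) + O * ((δ ∸ 5) * (δ ∸ 5) + 25 * r)
  ≡⟨ r₁ F O (suc δ * suc δ) ((δ ∸ 5) * (δ ∸ 5)) r ⟩
    F * (suc δ * suc δ) + O * ((δ ∸ 5) * (δ ∸ 5)) + (F + O) * (25 * r)
  ≤⟨ +-monoˡ-≤ _ (square-drift δ F≤) ⟩
    (F + O) * (δ * δ + 25) + (F + O) * (25 * r)
  ≡⟨ r₂ (F + O) (δ * δ) r ⟩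
    (F + O) * (δ * δ + 25 * suc r) ∎
  where
  open ≤-Reasoning
  r₁ : ∀ F O a b r → F * (a + 25 * r) + O * (b + 25 * r) ≡ F * a + O * b + (F + O) * (25 * r)
  r₁ = solve-∀
  r₂ : ∀ L a r → L * (a + 25) + L * (25 * r) ≡ L * (a + 25 * suc r)
  r₂ = solve-∀
shortfall-drift {_} {F} {O} {r} {δ} refl (inj₂ (refl , refl)) = begin
    F * (25 * r) + O * (25 * r) ≡⟨ sym (*-distribʳ-+ (25 * r) F O) ⟩
    (F + O) * (25 * r) ≤⟨ *-monoʳ-≤ (F + O) (≤-trans (*-monoʳ-≤ 25 (n≤1+n r)) (m≤n+m _ (δ * δ))) ⟩
    (F + O) * (δ * δ + 25 * suc r) ∎
  where open ≤-Reasoning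

-- The last hypothesis records that each of `t` rounds removed at most `n` of the `n (n - 1) / 2`
-- edges.
length-lower : ∀ {n L} t k → k + 2 * t + 1 ≤ n → n * n ≤ 2 * L + 2 * (t * n) + n → n * k ≤ 2 * L
length-lower {n} {L} t k h len = +-cancelʳ-≤ (2 * (t * n) + n) _ _ (begin
    n * k + (2 * (t * n) + n) ≡⟨ r n k t ⟩
    n * (k + 2 * t + 1) ≤⟨ *-monoʳ-≤ n h ⟩
    n * n ≤⟨ len ⟩
    2 * L + 2 * (t * n) + n ≡⟨ +-assoc (2 * L) _ n ⟩
    2 * L + (2 * (t * n) + n) ∎)
  where
  open ≤-Reasoning
  r : ∀ n k t → n * k + (2 * (t * n) + n) ≡ n * (k + 2 * t + 1)
  r = solve-∀

-- Numerical estimates on the scale of n/1000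

module Scale {m : ℕ} (1000≤m : 1000 ≤ m) where

  1≤m : 1 ≤ m
  1≤m = ≤-trans (≤ᵇ⇒≤ 1 1000 _) 1000≤m

  module _ {n L t} (n≥ : 1000 * m ≤ n) (t≤ : t ≤ 180 * m) (len : n * n ≤ 2 * L + 2 * (t * n) + n) where

    639000m²≤ : 639000 * (m * m) ≤ 2 * L
    639000m²≤ = begin
        639000 * (m * m) ≡⟨ r₁ 1000 639 m ⟩
        1000 * m * (639 * m) ≤⟨ *-monoˡ-≤ (639 * m) n≥ ⟩
        n * (639 * m) ≤⟨ length-lower {n} {L} t (639 * m) room len ⟩
        2 * L ∎
      where
      open ≤-Reasoning
      r₁ : ∀ a b m → a * b * (m * m) ≡ a * m * (b * m)
      r₁ = solve-∀
      r₂ : ∀ m → 639 * m + 2 * (180 * m) + m ≡ 1000 * m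
      r₂ = solve-∀
      room : 639 * m + 2 * t + 1 ≤ n
      room = ≤-trans (+-mono-≤ (+-monoʳ-≤ (639 * m) (*-monoʳ-≤ 2 t≤)) 1≤m) (≤-trans (≤-reflexive (r₂ m)) n≥)

    denominator≤ : suc (288000 * (m * m)) ≤ L
    denominator≤ = *-cancelˡ-≤ 2 (≤-trans bound 639000m²≤)
      where
      open ≤-Reasoning
      r₁ : ∀ k z → 2 * (z + k * z) ≡ 2 * (1 + k) * z
      r₁ = solve-∀
      bound : 2 * suc (288000 * (m * m)) ≤ 639000 * (m * m)
      bound = begin
        2 * suc (288000 * (m * m)) ≤⟨ *-monoʳ-≤ 2 (+-monoˡ-≤ (288000 * (m * m)) (*-mono-≤ 1≤m 1≤m)) ⟩
        2 * (m * m + 288000 * (m * m)) ≡⟨ r₁ 288000 (m * m) ⟩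
        576002 * (m * m) ≤⟨ *-monoˡ-≤ (m * m) (≤ᵇ⇒≤ 576002 639000 _) ⟩
        639000 * (m * m) ∎

    unit²≤ : ∀ {u} → u ≤ 10 * m + 10 → 512 * (u * u) ≤ L
    unit²≤ {u} u≤ = *-cancelˡ-≤ 2 (begin
        2 * (512 * (u * u)) ≤⟨ *-monoʳ-≤ 2 (*-monoʳ-≤ 512 (*-mono-≤ u≤11m u≤11m)) ⟩
        2 * (512 * (11 * m * (11 * m))) ≡⟨ r₁ 512 11 m ⟩
        123904 * (m * m) ≤⟨ *-monoˡ-≤ (m * m) (≤ᵇ⇒≤ 123904 639000 _) ⟩
        639000 * (m * m) ≤⟨ 639000m²≤ ⟩
        2 * L ∎)
      where
      open ≤-Reasoning
      r₁ : ∀ a b m → 2 * (a * (b * m * (b * m))) ≡ 2 * (a * (b * b)) * (m * m)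
      r₁ = solve-∀
      r₂ : ∀ m → 10 * m + m ≡ 11 * m
      r₂ = solve-∀
      u≤11m : u ≤ 11 * m
      u≤11m = ≤-trans u≤ (≤-trans (+-monoʳ-≤ (10 * m) (≤-trans (≤ᵇ⇒≤ 10 1000 _) 1000≤m)) (≤-reflexive (r₂ m)))

  -- O edges meet exactly one fresh vertex and F edges two; there are c hubs and
  -- φ fresh vertices.
  one-fresh-rare : ∀ {n L F O M u x c φ} → 1000 * m ≤ n → x + c ≤ 180 * m → u ≤ 10 * m + 10 →
    n * n ≤ 2 * L + 2 * ((x + c) * n) + n → F + O ≡ L → O ≤ M + c * φ → φ + (x + 2 * c) ≡ n →
    2 * M ≤ (2 * u + 1) * (x + c) → 256 * O + 8 * F ≤ 127 * L
  one-fresh-rare {n} {L} {F} {O} {M} {u} {x} {c} {φ} n≥ t≤ u≤ len FO O≤ φ≡ M≤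
    with slack t≤ | slack n≥
  ... | s , T≡ | y , n≡ = begin
      256 * O + 8 * F ≡⟨ trans (r₁ F O) (cong (λ z → 248 * O + 8 * z) FO) ⟩
      248 * O + 8 * L ≤⟨ +-monoˡ-≤ (8 * L) 248O≤ ⟩
      119 * L + 8 * L ≡⟨ r₂ L ⟩
      127 * L ∎
    where
    open ≤-Reasoning
    r₁ : ∀ F O → 256 * O + 8 * F ≡ 248 * O + 8 * (F + O)
    r₁ = solve-∀
    r₂ : ∀ L → 119 * L + 8 * L ≡ 127 * L
    r₂ = solve-∀
    τ p : ℕ
    τ = 180 * m
    p = 640 * m + y
    φ-eq : φ ≡ 2 * s + x + p
    φ-eq = +-cancelʳ-≡ (x + 2 * c) _ _ (trans φ≡ (trans n≡ (trans (r m y) (trans (cong (λ z → 2 * z + p) T≡) (r′ x c s p)))))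
      where
      r : ∀ m y → 1000 * m + y ≡ 2 * (180 * m) + (640 * m + y)
      r = solve-∀
      r′ : ∀ x c s p → 2 * (x + c + s) + p ≡ 2 * s + x + p + (x + 2 * c)
      r′ = solve-∀
    -- Here `τ + p` is `n - τ`. Every move uses up a fresh vertex, so for `t = x + c` the product is
    -- at most `t (n - t)`, which increases up to `t = τ`.
    cφ≤ : c * φ ≤ τ * (τ + p)
    cφ≤ = subst₂ _≤_ (cong (c *_) (sym φ-eq)) (cong (λ z → z * (z + p)) (sym T≡))
      (gap (c * c + x * c + x * x + 2 * (x * s) + x * p + s * s + s * p) (r x c s p))
      where
      r : ∀ x c s p → (x + c + s) * (x + c + s + p) ≡
        c * (2 * s + x + p) + (c * c + x * c + x * x + 2 * (x * s) + x * p + s * s + s * p)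
      r = solve-∀
    2M≤ : 2 * M ≤ 21 * m * τ
    2M≤ = ≤-trans M≤ (*-mono-≤ 2u+1≤ t≤)
      where
      r : ∀ m → 2 * (10 * m + 10) + 1 ≡ 20 * m + 21
      r = solve-∀
      r′ : ∀ m → 20 * m + m ≡ 21 * m
      r′ = solve-∀
      2u+1≤ : 2 * u + 1 ≤ 21 * m
      2u+1≤ = ≤-trans (+-monoˡ-≤ 1 (*-monoʳ-≤ 2 u≤)) (≤-trans (≤-reflexive (r m))
        (≤-trans (+-monoʳ-≤ (20 * m) (≤-trans (≤ᵇ⇒≤ 21 1000 _) 1000≤m)) (≤-reflexive (r′ m))))
    nk≤ : n * (639 * m + y) ≤ 2 * L
    nk≤ = length-lower {n} {L} (x + c) (639 * m + y) room len
      where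
      r : ∀ m y → 639 * m + y + 2 * (180 * m) + m ≡ 1000 * m + y
      r = solve-∀
      room : 639 * m + y + 2 * (x + c) + 1 ≤ n
      room = ≤-trans (+-mono-≤ (+-monoʳ-≤ (639 * m + y) (*-monoʳ-≤ 2 t≤)) 1≤m)
        (≤-reflexive (trans (r m y) (sym n≡)))
    -- Taking `8 (F + O) = 8 L` off the goal leaves 248 = 256 - 8 and 119 = 127 - 8.
    248O≤ : 248 * O ≤ 119 * L
    248O≤ = *-cancelˡ-≤ 2 (begin
        2 * (248 * O) ≤⟨ *-monoʳ-≤ 2 (*-monoʳ-≤ 248 O≤) ⟩
        2 * (248 * (M + c * φ)) ≡⟨ r₃ M (c * φ) ⟩
        248 * (2 * M) + 496 * (c * φ) ≤⟨ +-mono-≤ (*-monoʳ-≤ 248 2M≤) (*-monoʳ-≤ 496 cφ≤) ⟩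
        248 * (21 * m * (180 * m)) + 496 * (180 * m * (180 * m + (640 * m + y))) ≡⟨ r₄ 248 21 180 496 640 m y ⟩
        74147040 * (m * m) + 89280 * (m * y) ≤⟨ +-mono-≤ (*-monoˡ-≤ (m * m) (≤ᵇ⇒≤ 74147040 76041000 _)) (*-monoˡ-≤ (m * y) (≤ᵇ⇒≤ 89280 195041 _)) ⟩
        76041000 * (m * m) + 195041 * (m * y) ≤⟨ m≤m+n _ (119 * (y * y)) ⟩
        76041000 * (m * m) + 195041 * (m * y) + 119 * (y * y) ≡⟨ sym (r₆ 119 1000 639 m y) ⟩
        119 * ((1000 * m + y) * (639 * m + y)) ≡⟨ cong (λ z → 119 * (z * (639 * m + y))) (sym n≡) ⟩
        119 * (n * (639 * m + y)) ≤⟨ *-monoʳ-≤ 119 nk≤ ⟩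
        119 * (2 * L) ≡⟨ r₅ L ⟩
        2 * (119 * L) ∎)
      where
      r₃ : ∀ M z → 2 * (248 * (M + z)) ≡ 248 * (2 * M) + 496 * z
      r₃ = solve-∀
      r₄ : ∀ a b c d e m y → a * (b * m * (c * m)) + d * (c * m * (c * m + (e * m + y))) ≡
        (a * (b * c) + d * (c * (c + e))) * (m * m) + d * c * (m * y)
      r₄ = solve-∀
      r₆ : ∀ a b c m y → a * ((b * m + y) * (c * m + y)) ≡ a * (b * c) * (m * m) + a * (b + c) * (m * y) + a * (y * y)
      r₆ = solve-∀
      r₅ : ∀ L → 119 * (2 * L) ≡ 2 * (119 * L)
      r₅ = solve-∀

  -- With `v` rounds left before `180 m`, `φ ≤ 653 m + 2 v` while `2 L ≥ n (639 m + 2 v)`. The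
  -- comparison is tightest at `v = 80 m`, where 6 * 813² = 3965814 is just below 5 * 1000 * 799 =
  -- 3995000. This is why the rate 1/6 is claimed only from round `100 m` on.
  one-fresh-frequent : ∀ {n L F O x c φ} → 1000 * m ≤ n → n ≤ 1001 * m → 100 * m ≤ x + c → x + c ≤ 180 * m → x ≤ 12 * m →
    n * n ≤ 2 * L + 2 * ((x + c) * n) + n → F + O ≡ L → 2 * F ≤ φ * φ → φ + (x + 2 * c) ≡ n → F ≤ 5 * O
  one-fresh-frequent {n} {L} {F} {O} {x} {c} {φ} n≥ n≤ t≥ t≤ x≤ len FO F≤ φ≡ with slack t≤
  ... | v , T≡ = +-cancelˡ-≤ (5 * F) _ _ (begin
      5 * F + F ≡⟨ r₁ F ⟩
      6 * F ≤⟨ *-cancelˡ-≤ 2 12F≤ ⟩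
      5 * L ≡⟨ trans (cong (5 *_) (sym FO)) (*-distribˡ-+ 5 F O) ⟩
      5 * F + 5 * O ∎)
    where
    open ≤-Reasoning
    r₁ : ∀ F → 5 * F + F ≡ 6 * F
    r₁ = solve-∀
    v≤ : v ≤ 80 * m
    v≤ = +-cancelˡ-≤ (100 * m) _ _ (≤-trans (+-monoˡ-≤ v t≥) (≤-reflexive (trans (sym T≡) (r m))))
      where
      r : ∀ m → 180 * m ≡ 100 * m + 80 * m
      r = solve-∀
    φ≤ : φ ≤ 653 * m + 2 * v
    φ≤ = +-cancelʳ-≤ (2 * (x + c)) _ _ (begin
      φ + 2 * (x + c) ≡⟨ trans (r φ x c) (cong (_+ x) φ≡) ⟩
      n + x ≤⟨ +-mono-≤ n≤ x≤ ⟩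
      1001 * m + 12 * m ≡⟨ trans (r′ m) (trans (cong (λ z → 653 * m + 2 * z) T≡) (r″ m v (x + c))) ⟩
      653 * m + 2 * v + 2 * (x + c) ∎)
      where
      r : ∀ φ x c → φ + 2 * (x + c) ≡ φ + (x + 2 * c) + x
      r = solve-∀
      r′ : ∀ m → 1001 * m + 12 * m ≡ 653 * m + 2 * (180 * m)
      r′ = solve-∀
      r″ : ∀ m v t → 653 * m + 2 * (t + v) ≡ 653 * m + 2 * v + 2 * t
      r″ = solve-∀
    nk≤ : n * (639 * m + 2 * v) ≤ 2 * L
    nk≤ = length-lower {n} {L} (x + c) (639 * m + 2 * v) room len
      where
      r : ∀ m v t → 639 * m + 2 * v + 2 * t + m ≡ 640 * m + 2 * (t + v)
      r = solve-∀
      r′ : ∀ m → 640 * m + 2 * (180 * m) ≡ 1000 * m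
      r′ = solve-∀
      room : 639 * m + 2 * v + 2 * (x + c) + 1 ≤ n
      room = ≤-trans (+-monoʳ-≤ (639 * m + 2 * v + 2 * (x + c)) 1≤m)
        (≤-trans (≤-reflexive (trans (r m v (x + c)) (trans (cong (λ z → 640 * m + 2 * z) (sym T≡)) (r′ m)))) n≥)
    12F≤ : 2 * (6 * F) ≤ 2 * (5 * L)
    12F≤ = begin
      2 * (6 * F) ≡⟨ r₂ F ⟩
      6 * (2 * F) ≤⟨ *-monoʳ-≤ 6 (≤-trans F≤ (*-mono-≤ φ≤ φ≤)) ⟩
      6 * ((653 * m + 2 * v) * (653 * m + 2 * v)) ≡⟨ r₃ 653 m v ⟩
      2558454 * (m * m) + 15672 * (m * v) + 24 * (v * v) ≤⟨ +-monoʳ-≤ (2558454 * (m * m) + 15672 * (m * v)) (*-monoʳ-≤ 24 v²≤) ⟩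
      2558454 * (m * m) + 15672 * (m * v) + 24 * (80 * (m * v)) ≡⟨ r₄ (2558454 * (m * m)) 10000 5672 24 80 (m * v) ⟩
      2558454 * (m * m) + 10000 * (m * v) + 7592 * (m * v) ≤⟨ +-monoʳ-≤ (2558454 * (m * m) + 10000 * (m * v)) (*-monoʳ-≤ 7592 mv≤) ⟩
      2558454 * (m * m) + 10000 * (m * v) + 7592 * (80 * (m * m)) ≡⟨ r₅ 2558454 7592 80 (m * m) (10000 * (m * v)) ⟩
      3165814 * (m * m) + 10000 * (m * v) ≤⟨ +-monoˡ-≤ (10000 * (m * v)) (*-monoˡ-≤ (m * m) (≤ᵇ⇒≤ 3165814 3195000 _)) ⟩
      3195000 * (m * m) + 10000 * (m * v) ≡⟨ sym (r₇ 1000 639 m v) ⟩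
      5 * (1000 * m * (639 * m + 2 * v)) ≤⟨ *-monoʳ-≤ 5 (*-monoˡ-≤ (639 * m + 2 * v) n≥) ⟩
      5 * (n * (639 * m + 2 * v)) ≤⟨ *-monoʳ-≤ 5 nk≤ ⟩
      5 * (2 * L) ≡⟨ r₆ L ⟩
      2 * (5 * L) ∎
      where
      r₂ : ∀ F → 2 * (6 * F) ≡ 6 * (2 * F)
      r₂ = solve-∀
      r₃ : ∀ a m v → 6 * ((a * m + 2 * v) * (a * m + 2 * v)) ≡ 6 * (a * a) * (m * m) + 24 * a * (m * v) + 24 * (v * v)
      r₃ = solve-∀
      r₄ : ∀ z a b c d q → z + (a + b) * q + c * (d * q) ≡ z + a * q + (b + c * d) * q
      r₄ = solve-∀
      r₅ : ∀ a b c p z → a * p + z + b * (c * p) ≡ (a + b * c) * p + z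
      r₅ = solve-∀
      r₇ : ∀ a b m v → 5 * (a * m * (b * m + 2 * v)) ≡ 5 * (a * b) * (m * m) + 5 * (a * 2) * (m * v)
      r₇ = solve-∀
      v²≤ : v * v ≤ 80 * (m * v)
      v²≤ = ≤-trans (*-monoˡ-≤ v v≤) (≤-reflexive (*-assoc 80 m v))
      mv≤ : m * v ≤ 80 * (m * m)
      mv≤ = ≤-trans (*-monoʳ-≤ m v≤) (≤-reflexive (r 80 m))
        where
        r : ∀ a m → m * (a * m) ≡ a * (m * m)
        r = solve-∀
      r₆ : ∀ L → 5 * (2 * L) ≡ 2 * (5 * L)
      r₆ = solve-∀

  -- The shortfall is at least `80 m - 72 m = 8 m`, and 4500 = 288000 / 64.
  shortfall-fatal : ∀ {x} → x < 12 * m → 288000 * (m * m) ≤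
    4500 * ((180 * m ∸ 100 * m ∸ 6 * x) * (180 * m ∸ 100 * m ∸ 6 * x))
  shortfall-fatal {x} x< = ≤-trans (≤-reflexive (r₁ 4500 8 m)) (*-monoʳ-≤ 4500 (*-mono-≤ 8m≤ 8m≤))
    where
    open ≤-Reasoning
    r₁ : ∀ a b m → a * (b * b) * (m * m) ≡ a * (b * m * (b * m))
    r₁ = solve-∀
    r₂ : ∀ m → 6 * (12 * m) ≡ 72 * m
    r₂ = solve-∀
    8m≤ : 8 * m ≤ 180 * m ∸ 100 * m ∸ 6 * x
    8m≤ = begin
      8 * m ≡⟨ *-distribʳ-∸ m 80 72 ⟩
      80 * m ∸ 72 * m ≡⟨ cong₂ _∸_ (*-distribʳ-∸ m 180 100) (sym (r₂ m)) ⟩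
      180 * m ∸ 100 * m ∸ 6 * (12 * m) ≤⟨ ∸-monoʳ-≤ (180 * m ∸ 100 * m) (*-monoʳ-≤ 6 (<⇒≤ x<)) ⟩
      180 * m ∸ 100 * m ∸ 6 * x ∎

-- The game

module _ {n : ℕ} (D : ℕ) where
  open Losing (breaker n) D

  -- Every move costs at most `n - x ≤ b`, so no edge of priority at most 3 survives a reply: Maker
  -- can only join two fresh vertices or attach one to a hub.
  late : ∀ f {mk br us x c} → Position mk us x c → count≤ 3 (roles mk) us ≡ 0 → n ∸ bias n ≤ x →
    length us ≤ f → LosesAtMost f mk br us 0
  late f {mk} {br} {[]} P _ _ _ = loses-never {f} {mk} {br} (forest-wins (Position.forest P))
  late (suc f) {mk} {br} {us@(_ ∷ us′)} {x} {c} P M≡0 x≥ (s≤s len) =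
    loses-step {f = f} {mk} {br} {us} (λ _ → 0) (s≤s z≤n) next
      (≤-reflexive (trans (∑-zero us) (sym (*-zeroʳ (length us)))))
    where
    next : ∀ {e rest} → (e , rest) ∈ picks us →
      let mk′ = mk ++ e ∷ [] ; sp = split rest (breaker n mk′ br rest) in
      LosesAtMost f mk′ (br ++ proj₁ sp) (proj₂ sp) 0
    next {e} {rest} pick = reply (move ρ e)
      where
      open Reply mk br pick
      open Position P
      br′ = br ++ proj₁ (split rest (breaker n mk′ br rest))
      length≤ : length u′ ≤ f
      length≤ = ≤-trans (≤-reflexive length-u′) (≤-trans (m∸n≤m (length us′) b) len)
      cleared : ∀ {k} → count≤ 3 (roles mk′) u′ ≤ count≤ 3 ρ us + k ∸ b → k ≤ n ∸ x → count≤ 3 (roles mk′) u′ ≡ 0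
      cleared {k} h k≤ = n≤0⇒n≡0 (≤-trans h (≤-reflexive (trans (cong (λ M → M + k ∸ b) M≡0) (m≤n⇒m∸n≡0 k≤b))))
        where
        k≤b : k ≤ b
        k≤b = ≤-trans k≤ (m≤n+o⇒m∸n≤o n x (≤-trans (m≤n+m∸n n b) (≤-trans (+-monoʳ-≤ b x≥) (≤-reflexive (+-comm b x)))))
      x+c≤n : x + c ≤ n
      x+c≤n = ≤-trans (+-monoʳ-≤ x (m≤m+n c (c + 0))) (≤-trans (m≤n+m (x + 2 * c) (card (isFresh ∘ ρ))) (≤-reflexive (Census.freshes census)))
      c+k : c + (n ∸ (x + c)) ≡ n ∸ x
      c+k = trans (cong (c +_) (sym (∸-+-assoc n x c))) (m+[n∸m]≡n (m+n≤o⇒n≤o∸m x x+c≤n))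
        where
        m+n≤o⇒n≤o∸m : ∀ m {n o} → m + n ≤ o → n ≤ o ∸ m
        m+n≤o⇒n≤o∸m m {n} h = subst (_≤ _) (m+n∸m≡n m n) (∸-monoˡ-≤ m h)
      reply : Move ρ e → LosesAtMost f mk′ br′ u′ 0
      reply (both ρi ρj eq) = late f {mk′} {br′} (position) (cleared count₃ (≤-reflexive c+k)) x≥ length≤
        where open Both P ρi ρj eq
      reply (one f′ y joins ρf ρy eq level≡) =
        late f {mk′} {br′} (position not-twig) (cleared count₃ (∸-monoʳ-≤ n (m≤m+n x c))) (≤-trans x≥ (n≤1+n x)) length≤
        where
        open One P f′ y joins ρf ρy eq
        not-twig : ρ y ≢ twig
        not-twig t = absent 3 (≤-reflexive M≡0) (≤-trans (≤-reflexive (trans level≡ (cong level t))) (s≤s z≤n))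
      reply (none p) = absent 3 (≤-reflexive M≡0) (≤-trans (≤-reflexive p) z≤n)

-- The early phase lasts T₁ rounds; a shortfall of one-fresh moves below x₀ is
-- measured from round T₀ on against a rate of 1/6.
record Parameters (n D Z T₀ T₁ x₀ u : ℕ) : Set where
  field
    n≡ : n ≡ bias n + u
    bias< : bias n < n
    room : ∀ {x c} → x + c ≤ T₁ → x + 2 * c + suc (x + 2 * c) + 4 * u ≤ bias n
    u≤x₀ : u ≤ x₀
    cleared : ∀ {M x c} → x + c ≡ T₁ → x₀ ≤ x → Backlog u M x c → M ≡ 0
    fatal : ∀ {x} → x < x₀ → D ≤ Z * ((T₁ ∸ T₀ ∸ 6 * x) * (T₁ ∸ T₀ ∸ 6 * x))
    denominator : ∀ {L t} → t ≤ T₁ → n * n ≤ 2 * L + 2 * (t * n) + n → suc D ≤ L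
    unit² : ∀ {L t} → t ≤ T₁ → n * n ≤ 2 * L + 2 * (t * n) + n → 512 * (u * u) ≤ L
    rare : ∀ {L F O M x c φ} → x + c ≤ T₁ → n * n ≤ 2 * L + 2 * ((x + c) * n) + n → F + O ≡ L →
      O ≤ M + c * φ → φ + (x + 2 * c) ≡ n → 2 * M ≤ (2 * u + 1) * (x + c) → 256 * O + 8 * F ≤ 127 * L
    frequent : ∀ {L F O x c φ} → T₀ ≤ x + c → x + c ≤ T₁ → x < x₀ → n * n ≤ 2 * L + 2 * ((x + c) * n) + n →
      F + O ≡ L → 2 * F ≤ φ * φ → φ + (x + 2 * c) ≡ n → F ≤ 5 * O

-- Apart from pairs of fresh vertices, only edges from a hub to a fresh vertex have priority 4.
1∸ff≤ : ∀ r s → 1 ∸ isFresh r * isFresh s ≤ ⟦ priority r s ≤ᵇ 3 ⟧ + (isHub r * isFresh s + isHub s * isFresh r)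
1∸ff≤ fresh = role-≤ (λ s → 1 ∸ isFresh fresh * isFresh s) _
1∸ff≤ hub = role-≤ (λ s → 1 ∸ isFresh hub * isFresh s) _
1∸ff≤ rim = role-≤ (λ s → 1 ∸ isFresh rim * isFresh s) _
1∸ff≤ leaf = role-≤ (λ s → 1 ∸ isFresh leaf * isFresh s) _
1∸ff≤ twig = role-≤ (λ s → 1 ∸ isFresh twig * isFresh s) _

module _ {n : ℕ} (ρ : Roles n) where

  twoFresh notTwoFresh : Edge n → ℕ
  twoFresh = onPair λ i j → isFresh (ρ i) * isFresh (ρ j)
  notTwoFresh e = 1 ∸ twoFresh e

  module _ {us : List (Edge n)} (us≼ : us ≼allEdges) where

    twoFresh-total : ∑ us twoFresh + ∑ us notTwoFresh ≡ length us
    twoFresh-total = trans (sym (∑-+ us twoFresh notTwoFresh)) (trans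
      (∑-cong us λ e → m+[n∸m]≡n (bound (ρ (proj₁ (proj₁ e))) (ρ (proj₂ (proj₁ e))))) (∑-one us))
      where
      bound : ∀ r s → isFresh r * isFresh s ≤ 1
      bound r s = *-mono-≤ {isFresh r} {1} {isFresh s} {1} (role-≤ isFresh (λ _ → 1) r) (role-≤ isFresh (λ _ → 1) s)

    twoFresh-≤ : 2 * ∑ us twoFresh ≤ card (isFresh ∘ ρ) * card (isFresh ∘ ρ)
    twoFresh-≤ = begin
      2 * ∑ us twoFresh ≡⟨ sym (∑-*ˡ us 2 twoFresh) ⟩
      ∑ us (λ e → 2 * twoFresh e) ≡⟨ ∑-cong us (λ e → r (isFresh (ρ (proj₁ (proj₁ e)))) _) ⟩
      ∑ us (onPair λ i j → isFresh (ρ i) * isFresh (ρ j) + isFresh (ρ j) * isFresh (ρ i)) ≤⟨ us≼ _ ⟩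
      ∑ (allEdges n) (onPair λ i j → isFresh (ρ i) * isFresh (ρ j) + isFresh (ρ j) * isFresh (ρ i))
        ≤⟨ allEdges-product (isFresh ∘ ρ) (isFresh ∘ ρ) ⟩
      card (isFresh ∘ ρ) * card (isFresh ∘ ρ) ∎
      where
      open ≤-Reasoning
      r : ∀ a b → 2 * (a * b) ≡ a * b + b * a
      r = solve-∀

    notTwoFresh-≤ : ∑ us notTwoFresh ≤ count≤ 3 ρ us + card (isHub ∘ ρ) * card (isFresh ∘ ρ)
    notTwoFresh-≤ = begin
      ∑ us notTwoFresh
        ≤⟨ ∑-mono us (λ e → 1∸ff≤ (ρ (proj₁ (proj₁ e))) (ρ (proj₂ (proj₁ e)))) ⟩
      ∑ us (λ e → ⟦ edgePriority ρ e ≤ᵇ 3 ⟧ + onPair hf e) ≡⟨ ∑-+ us _ (onPair hf) ⟩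
      count≤ 3 ρ us + ∑ us (onPair hf)
        ≤⟨ +-monoʳ-≤ (count≤ 3 ρ us) (≤-trans (us≼ _) (allEdges-product (isHub ∘ ρ) (isFresh ∘ ρ))) ⟩
      count≤ 3 ρ us + card (isHub ∘ ρ) * card (isFresh ∘ ρ) ∎
      where
      open ≤-Reasoning
      hf : Fin n → Fin n → ℕ
      hf i j = isHub (ρ i) * isFresh (ρ j) + isHub (ρ j) * isFresh (ρ i)

-- The early phase and its potential

module Phase {n D Z T₀ T₁ x₀ u : ℕ} (parameters : Parameters n D Z T₀ T₁ x₀ u) where
  open Parameters parameters
  open Losing (breaker n) D

  -- After x one-fresh and c two-fresh moves: the edges at leaves and twigs take
  -- q rounds of u edges to clear, and ε tells whether there are any at twigs.
  record Early (mk us : List (Edge n)) (x c q : ℕ) (ε : Bool) : Set where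
    field
      position : Position mk us x c
      size : n * n ≤ 2 * length us + 2 * ((x + c) * n) + n
      inner : count≤ 0 (roles mk) us ≤ 0
      twigs : count≤ 1 (roles mk) us ≤ ⟦ ε ⟧ * u
      queue : count≤ 2 (roles mk) us ≤ q * u
      backlog : Backlog u (count≤ 3 (roles mk) us) x c

  -- Moves made before `T₀` are credited in `x` too, which can only lower the value.
  shortfall : ℕ → ℕ → ℕ
  shortfall x c = x + c ∸ T₀ ∸ 6 * x

  -- Once the target is met the term is dropped for good, as `x` never decreases. The decision is an
  -- argument so that proofs can split on it alone.
  weigh : ∀ {x} → Dec (x < x₀) → ℕ → ℕ
  weigh (yes _) k = Z * k
  weigh (no _) _ = 0

  lag : ℕ → ℕ → ℕ → ℕ
  lag r x c = weigh (x <? x₀) (shortfall x c * shortfall x c + 25 * r)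

  base : ℕ → ℕ → ℕ → ℕ → ℕ
  base r x c q = 2 ^ q + r + lag r x c

  -- 2 ^ q pays for a twig arising at one of the exposed leaves, q u for a second
  -- move at an exposed leaf or twig, and the lag for a lack of one-fresh moves;
  -- the multiples of r absorb what these terms may gain in a round.
  potential : ℕ → ℕ → ℕ → ℕ → Bool → ℕ
  potential r x c q ε = base r x c q + ⟦ ε ⟧ * (q * u)

  suc-∸-≤ : ∀ s k → suc s ∸ k ≤ suc (s ∸ k)
  suc-∸-≤ s zero = ≤-refl
  suc-∸-≤ zero (suc k) = ≤-trans (≤-reflexive (0∸n≡0 k)) z≤n
  suc-∸-≤ (suc s) (suc k) = suc-∸-≤ s k

  lag-drift : ∀ {L F O x c} r → F + O ≡ L → (x < x₀ → T₀ ≤ x + c → F ≤ 5 * O) →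
    F * lag r x (suc c) + O * lag r (suc x) c ≤ L * lag (suc r) x c
  lag-drift {L} {F} {O} {x} {c} r FO frequent′ = decide (x <? x₀)
    where
    open ≤-Reasoning
    a b z : ℕ
    a = shortfall x (suc c) * shortfall x (suc c) + 25 * r
    b = shortfall (suc x) c * shortfall (suc x) c + 25 * r
    z = shortfall x c * shortfall x c + 25 * suc r
    regroup′ : ∀ z F a O b → F * (z * a) + O * (z * b) ≡ z * (F * a + O * b)
    regroup′ = solve-∀
    commute : ∀ z L k → z * (L * k) ≡ L * (z * k)
    commute = solve-∀
    weigh≤ : ∀ d {k} → weigh {suc x} d k ≤ Z * k
    weigh≤ (yes _) = ≤-refl
    weigh≤ (no _) = z≤n
    later : x + suc c ∸ T₀ ∸ 6 * x ≤ suc (shortfall x c)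
    later = ≤-trans (∸-monoˡ-≤ (6 * x) (≤-trans (≤-reflexive (cong (_∸ T₀) (+-suc x c))) (suc-∸-≤ (x + c) T₀)))
      (suc-∸-≤ (x + c ∸ T₀) (6 * x))
    sooner : suc (x + c) ∸ T₀ ∸ 6 * suc x ≤ shortfall x c ∸ 5
    sooner = ≤-trans (∸-monoˡ-≤ (6 * suc x) (suc-∸-≤ (x + c) T₀)) (≤-reflexive (trans
      (cong (suc (x + c ∸ T₀) ∸_) (six x)) (trans (cong (x + c ∸ T₀ ∸_) (+-comm 5 (6 * x))) (sym (∸-+-assoc (x + c ∸ T₀) (6 * x) 5)))))
      where
      six : ∀ x → 6 * suc x ≡ suc (5 + 6 * x)
      six = solve-∀
    cases : x < x₀ → (F ≤ 5 * O × shortfall x (suc c) ≤ suc (shortfall x c) × shortfall (suc x) c ≤ shortfall x c ∸ 5)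
      ⊎ (shortfall x (suc c) ≡ 0 × shortfall (suc x) c ≡ 0)
    cases x< with T₀ ≤? x + c
    ... | yes T₀≤ = inj₁ (frequent′ x< T₀≤ , later , sooner)
    ... | no T₀≰ = inj₂ (none′ (x + suc c) (6 * x) (≤-trans (≤-reflexive (+-suc x c)) (≰⇒> T₀≰)) , none′ (suc (x + c)) (6 * suc x) (≰⇒> T₀≰))
      where
      none′ : ∀ t k → t ≤ T₀ → t ∸ T₀ ∸ k ≡ 0
      none′ t k t≤ = trans (cong (_∸ k) (m≤n⇒m∸n≡0 t≤)) (0∸n≡0 k)
    decide : (d : Dec (x < x₀)) → F * weigh d a + O * lag r (suc x) c ≤ L * weigh d z
    decide (no x≮) = ≤-trans (≤-reflexive (cong₂ _+_ (*-zeroʳ F) (trans (cong (O *_) (vanish (suc x <? x₀))) (*-zeroʳ O)))) z≤n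
      where
      vanish : ∀ d {k} → weigh {suc x} d k ≡ 0
      vanish (yes p) = ⊥-elim (x≮ (<⇒≤ p))
      vanish (no _) = refl
    decide (yes x<) = begin
      F * (Z * a) + O * weigh (suc x <? x₀) b ≤⟨ +-monoʳ-≤ (F * (Z * a)) (*-monoʳ-≤ O (weigh≤ (suc x <? x₀))) ⟩
      F * (Z * a) + O * (Z * b) ≡⟨ regroup′ Z F a O b ⟩
      Z * (F * a + O * b) ≤⟨ *-monoʳ-≤ Z (shortfall-drift {δ = shortfall x c} FO (cases x<)) ⟩
      Z * (L * z) ≡⟨ commute Z L z ⟩
      L * (Z * z) ∎

  -- The spare `L` in the power estimate is paid for by the drop from `suc r` to `r`.
  combine : ∀ {L F O E y w p p′ p″ r a b z} → F + O ≡ L → F * p′ + O * p″ + y ≤ L * p + L →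
    F * a + O * b ≤ L * z → E ≤ y + L * w → F * (p′ + r + a) + O * (p″ + r + b) + E ≤ L * (p + suc r + z + w)
  combine {_} {F} {O} {E} {y} {w} {p} {p′} {p″} {r} {a} {b} {z} refl h₁ h₂ h₃ = begin
      F * (p′ + r + a) + O * (p″ + r + b) + E
    ≤⟨ +-monoʳ-≤ (F * (p′ + r + a) + O * (p″ + r + b)) h₃ ⟩
      F * (p′ + r + a) + O * (p″ + r + b) + (y + (F + O) * w)
    ≡⟨ r₁ F O y w p′ p″ r a b ⟩
      (F * p′ + O * p″ + y) + (F * a + O * b) + (F + O) * (r + w)
    ≤⟨ +-monoˡ-≤ _ (+-mono-≤ h₁ h₂) ⟩
      ((F + O) * p + (F + O)) + (F + O) * z + (F + O) * (r + w)
    ≡⟨ r₂ (F + O) p r z w ⟩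
      (F + O) * (p + suc r + z + w) ∎
    where
    open ≤-Reasoning
    r₁ : ∀ F O y w p′ p″ r a b → F * (p′ + r + a) + O * (p″ + r + b) + (y + (F + O) * w) ≡
      (F * p′ + O * p″ + y) + (F * a + O * b) + (F + O) * (r + w)
    r₁ = solve-∀
    r₂ : ∀ L p r z w → (L * p + L) + L * z + L * (r + w) ≡ L * (p + suc r + z + w)
    r₂ = solve-∀

  -- A move at a leaf or twig while twigs are exposed counts as a loss.
  surcharge : Bool → ℕ → ℕ
  surcharge false q = suc q * u
  surcharge true q = suc D

  -- Bounds the losing numerator after Maker takes `e`. Being a sum of multiples of indicators, it
  -- is averaged by knowing three edge counts.
  price : Roles n → ℕ → ℕ → ℕ → ℕ → Bool → Edge n → ℕ
  price ρ r x c q ε e = twoFresh ρ e * base r x (suc c) (q ∸ 4) + notTwoFresh ρ e * base r (suc x) c (suc q)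
    + ⟦ edgePriority ρ e ≤ᵇ 2 ⟧ * surcharge ε q

  module _ {mk us x c q ε} (E : Early mk us x c q ε) (t≤ : x + c ≤ T₁) where
    open Early E
    open Position position
    open Census census

    private
      ρ : Roles n
      ρ = roles mk
      L F O φ : ℕ
      L = length us
      F = ∑ us (twoFresh ρ)
      O = ∑ us (notTwoFresh ρ)
      φ = card (isFresh ∘ ρ)
      FO : F + O ≡ L
      FO = twoFresh-total ρ {us} available
      O≤ : O ≤ count≤ 3 ρ us + c * φ
      O≤ = subst (λ h → O ≤ count≤ 3 ρ us + h * φ) hubs (notTwoFresh-≤ ρ {us} available)

    denominator≤length : suc D ≤ L
    denominator≤length = denominator t≤ size

    -- Without exposed twigs, at most `q u` edges each cost `suc q * u`, the twig term of the next
    -- potential. With them, each costs `suc D ≤ L`, and the average `q u` is the twig term already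
    -- held.
    surcharge-total : count≤ 2 ρ us * surcharge ε q ≤ u * u * (q * suc q) + L * (⟦ ε ⟧ * (q * u))
    surcharge-total = bound ε
      where
      open ≤-Reasoning
      r₁ : ∀ q u → q * u * (suc q * u) ≡ u * u * (q * suc q)
      r₁ = solve-∀
      bound : ∀ ε → count≤ 2 ρ us * surcharge ε q ≤ u * u * (q * suc q) + L * (⟦ ε ⟧ * (q * u))
      bound false = begin
        count≤ 2 ρ us * (suc q * u) ≤⟨ *-monoˡ-≤ (suc q * u) queue ⟩
        q * u * (suc q * u) ≡⟨ r₁ q u ⟩
        u * u * (q * suc q) ≤⟨ m≤m+n _ _ ⟩
        u * u * (q * suc q) + L * 0 ∎
      bound true = begin
        count≤ 2 ρ us * suc D ≤⟨ *-mono-≤ queue denominator≤length ⟩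
        q * u * L ≡⟨ *-comm (q * u) L ⟩
        L * (q * u) ≡⟨ cong (L *_) (sym (*-identityˡ (q * u))) ⟩
        L * (1 * (q * u)) ≤⟨ m≤n+m _ (u * u * (q * suc q)) ⟩
        u * u * (q * suc q) + L * (1 * (q * u)) ∎

    price-drift : ∀ r → ∑ us (price ρ r x c q ε) ≤ L * potential (suc r) x c q ε
    price-drift r = ≤-trans (≤-reflexive total) (combine {L} {F} {O} {count≤ 2 ρ us * surcharge ε q} {u * u * (q * suc q)} {⟦ ε ⟧ * (q * u)}
      {2 ^ q} {2 ^ (q ∸ 4)} {2 ^ suc q} {r} {lag r x (suc c)} {lag r (suc x) c} {lag (suc r) x c} FO
      (power-drift {L} {F} {O} {u} {2 ^ q} {2 ^ (q ∸ 4)} {q * suc q} FO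
        (rare {L} {F} {O} {count≤ 3 ρ us} {x} {c} {φ} t≤ size FO O≤ freshes (backlog-bound {u} {count≤ 3 ρ us} {x} {c} backlog)) (unit² t≤ size) (16*2^[q∸4]≤ q) (q*[1+q]≤4*2^q q))
      (lag-drift {L} {F} {O} {x} {c} r FO λ x< T₀≤ → frequent {L} {F} {O} {x} {c} {φ} T₀≤ t≤ x< size FO (twoFresh-≤ ρ {us} available) freshes)
      surcharge-total)
      where
      B₁ = base r x (suc c) (q ∸ 4)
      B₂ = base r (suc x) c (suc q)
      scaled : ∀ f k → ∑ us (λ e → f e * k) ≡ ∑ us f * k
      scaled f k = trans (∑-cong us λ e → *-comm (f e) k) (trans (∑-*ˡ us k f) (*-comm k (∑ us f)))
      total : ∑ us (price ρ r x c q ε) ≡ F * B₁ + O * B₂ + count≤ 2 ρ us * surcharge ε q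
      total = trans (∑-+ us (λ e → twoFresh ρ e * B₁ + notTwoFresh ρ e * B₂) _)
        (cong₂ _+_ (trans (∑-+ us (λ e → twoFresh ρ e * B₁) _) (cong₂ _+_ (scaled (twoFresh ρ) B₁) (scaled (notTwoFresh ρ) B₂)))
          (scaled _ (surcharge ε q)))

  early : ∀ r f {mk br us x c q ε} → Early mk us x c q ε → x + c + r ≡ T₁ → length us ≤ f →
    LosesAtMost f mk br us (potential r x c q ε)
  early zero f {mk} {br} {us} {x} {c} {q} {ε} E t≡ len = decide (x <? x₀)
    where
    open Early E
    t≡′ : x + c ≡ T₁
    t≡′ = trans (sym (+-identityʳ _)) t≡
    decide : (d : Dec (x < x₀)) →
      LosesAtMost f mk br us (2 ^ q + 0 + weigh d (shortfall x c * shortfall x c + 0) + ⟦ ε ⟧ * (q * u))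
    -- The shortfall pays for `D`, and `2 ^ q ≥ 1` for the one missing up to `suc D`.
    decide (yes x<) = loses-certain {f} {mk} {br} {us} (≤-trans (+-mono-≤ (m^n>0 2 q) D≤) (≤-trans
      (≤-reflexive (cong (_+ Z * (shortfall x c * shortfall x c + 0)) (sym (+-identityʳ (2 ^ q))))) (m≤m+n _ (⟦ ε ⟧ * (q * u)))))
      where
      D≤ : D ≤ Z * (shortfall x c * shortfall x c + 0)
      D≤ = subst (λ t → D ≤ Z * ((t ∸ T₀ ∸ 6 * x) * (t ∸ T₀ ∸ 6 * x) + 0)) (sym t≡′)
        (≤-trans (fatal x<) (≤-reflexive (cong (Z *_) (sym (+-identityʳ _)))))
    decide (no x≮) = loses-mono {f} {mk} {br} {us} {0} {2 ^ q + 0 + weigh (no x≮) (shortfall x c * shortfall x c + 0) + ⟦ ε ⟧ * (q * u)} z≤n (late D f {mk} {br} position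
      (cleared t≡′ (≮⇒≥ x≮) backlog)
      (≤-trans (≤-reflexive (trans (cong (_∸ bias n) n≡) (m+n∸m≡n (bias n) u))) (≤-trans u≤x₀ (≮⇒≥ x≮))) len)
  early (suc r) f {mk} {br} {us} {x} {c} {q} {ε} E t≡ len = round f len
    where
    open Early E
    open Position position
    t< : suc (x + c) ≤ T₁
    t< = subst (suc (x + c) ≤_) (trans (sym (+-suc (x + c) r)) t≡) (m≤m+n (suc (x + c)) r)
    t≤ : x + c ≤ T₁
    t≤ = <⇒≤ t<
    round : ∀ f → length us ≤ f → LosesAtMost f mk br us (potential (suc r) x c q ε)
    round zero len = ⊥-elim (<⇒≱ (≤-trans (s≤s z≤n) (denominator≤length E t≤)) len)
    round (suc f) len = loses-step {f} {mk} {br} {us} (price (roles mk) r x c q ε)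
      (≤-trans (s≤s z≤n) (denominator≤length E t≤)) next (price-drift E t≤ r)
      where
      next : ∀ {e rest} → (e , rest) ∈ picks us →
        let mk′ = mk ++ e ∷ [] ; sp = split rest (breaker n mk′ br rest) in
        LosesAtMost f mk′ (br ++ proj₁ sp) (proj₂ sp) (price (roles mk) r x c q ε e)
      next {e} {rest} pick = reply (move ρ e)
        where
        open Reply mk br pick
        br′ : List (Edge n)
        br′ = br ++ proj₁ (split rest (breaker n mk′ br rest))
        τ : ℕ
        τ = x + 2 * c
        length≤ : length u′ ≤ f
        length≤ = ≤-trans (≤-reflexive length-u′) (≤-trans (∸-monoˡ-≤ (suc b) len) (m∸n≤m f b))
        size′ : ∀ x′ c′ → x′ + c′ ≡ suc (x + c) → n * n ≤ 2 * length u′ + 2 * ((x′ + c′) * n) + n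
        size′ x′ c′ eq = ≤-trans size (≤-trans (+-monoˡ-≤ n (+-monoˡ-≤ (2 * ((x + c) * n)) (*-monoʳ-≤ 2 shrink)))
          (≤-reflexive (trans (r₁ (length u′) n (x + c)) (cong (λ t → 2 * length u′ + 2 * (t * n) + n) (sym eq)))))
          where
          r₁ : ∀ l n t → 2 * (l + n) + 2 * (t * n) + n ≡ 2 * l + 2 * (suc t * n) + n
          r₁ = solve-∀
          shrink : length us ≤ length u′ + n
          shrink = ≤-trans (m≤n+m∸n (length us) (suc b)) (≤-trans (+-mono-≤ bias< (≤-reflexive (sym length-u′)))
            (≤-reflexive (+-comm n (length u′))))
        next-round : ∀ {x′ c′} → x′ + c′ ≡ suc (x + c) → x′ + c′ + r ≡ T₁
        next-round eq = trans (cong (_+ r) eq) (trans (sym (+-suc (x + c) r)) t≡)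
        wide : τ + suc τ + 4 * u ≤ b
        wide = room {x} {c} t≤
        -- This limits the exposure of a twig to one round: at most `u` leftover edges and the new
        -- ones between touched vertices fit into a single reply.
        none≤ : ∀ {a k} → a ≤ u → k ≤ τ + suc τ → a + k ∸ b ≤ 0
        none≤ {a} {k} a≤ k≤ = ≤-reflexive (m≤n⇒m∸n≡0 (≤-trans (+-mono-≤ a≤ k≤)
          (≤-trans (≤-trans (≤-reflexive (+-comm u _)) (+-monoʳ-≤ (τ + suc τ) (m≤m+n u (3 * u)))) wide)))
        twigs≤u : count≤ 1 ρ us ≤ u
        twigs≤u = ≤-trans twigs (bound ε)
          where
          bound : ∀ ε → ⟦ ε ⟧ * u ≤ u
          bound true = ≤-reflexive (+-identityʳ u)
          bound false = z≤n
        inner≤u : count≤ 0 ρ us ≤ u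
        inner≤u = ≤-trans inner z≤n
        τ≤ : τ ≤ τ + suc τ
        τ≤ = m≤m+n τ (suc τ)
        reply : Move ρ e → LosesAtMost f mk′ br′ u′ (price ρ r x c q ε e)
        reply (both ρi ρj eq) = loses-mono {f} {mk′} {br′} {u′} cost
          (early r f {mk′} {br′} {u′} {x} {suc c} {q ∸ 4} {false} E′ (next-round {x} {suc c} (+-suc x c)) length≤)
          where
          open Both position ρi ρj eq renaming (position to position′)
          E′ : Early mk′ u′ x (suc c) (q ∸ 4) false
          E′ = record
            { position = position′
            ; size = size′ x (suc c) (+-suc x c)
            ; inner = ≤-trans (count₀₁₂ 0 z≤n) (none≤ inner≤u ≤-refl)
            ; twigs = ≤-trans (count₀₁₂ 1 (s≤s z≤n)) (none≤ twigs≤u ≤-refl)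
            ; queue = queue-both {q = q} wide queue (count₀₁₂ 2 ≤-refl)
            ; backlog = backlog-both {u} {count≤ 3 ρ us} {count≤ 3 (roles mk′) u′} {x} {c} {c + (n ∸ (x + c))} {b} count₃ (arrange n≡) backlog
            }
            where
            open Census census
            arrange : n ≡ b + u → c + (n ∸ (x + c)) + x ≡ b + u
            arrange e = trans (r₁ c _ x) (trans (m∸n+n≡m x+c≤n) e)
              where
              r₁ : ∀ c k x → c + k + x ≡ k + (x + c)
              r₁ = solve-∀
              x+c≤n : x + c ≤ n
              x+c≤n = ≤-trans (+-monoʳ-≤ x (m≤m+n c (c + 0))) (≤-trans (m≤n+m (x + 2 * c) (card (isFresh ∘ ρ))) (≤-reflexive freshes))
          twoFresh≡1 : twoFresh ρ e ≡ 1
          twoFresh≡1 = cong₂ (λ r s → isFresh r * isFresh s) ρi ρj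
          cost : potential r x (suc c) (q ∸ 4) false ≤ price ρ r x c q ε e
          cost = ≤-trans (≤-reflexive (trans (+-identityʳ _) (trans (sym (+-identityʳ _)) (cong (_* κ) (sym twoFresh≡1)))))
            (≤-trans (m≤m+n _ _) (m≤m+n _ _))
            where κ = base r x (suc c) (q ∸ 4)
        reply (one f′ y joins ρf ρy eq level≡) = attach (ρ y) refl
          where
          open One position f′ y joins ρf ρy eq renaming (position to position′)
          open Census census
          arrange : n ≡ b + u → n ∸ (x + c) + (x + c) ≡ b + u
          arrange e = trans (m∸n+n≡m (≤-trans (+-monoʳ-≤ x (m≤m+n c (c + 0)))
            (≤-trans (m≤n+m (x + 2 * c) (card (isFresh ∘ ρ))) (≤-reflexive freshes)))) e
          E′ : ∀ {ε′} → ρ y ≢ twig → count≤ 1 (roles mk′) u′ ≤ ⟦ ε′ ⟧ * u → Early mk′ u′ (suc x) c (suc q) ε′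
          E′ not-twig twigs′ = record
            { position = position′ not-twig
            ; size = size′ (suc x) c refl
            ; inner = ≤-trans count₀ (none≤ inner≤u τ≤)
            ; twigs = twigs′
            ; queue = queue-one {q = q} n≡ queue (count₁₂ 2)
            ; backlog = backlog-one {u} {count≤ 3 ρ us} {count≤ 3 (roles mk′) u′} {x} {c} {n ∸ (x + c)} {b} count₃ (arrange n≡) backlog
            }
          κ : ℕ
          κ = base r (suc x) c (suc q)
          κ≤ : κ ≤ twoFresh ρ e * base r x (suc c) (q ∸ 4) + notTwoFresh ρ e * κ
          κ≤ = ≤-trans (≤-reflexive (trans (sym (+-identityʳ κ)) (cong (λ z → (1 ∸ z) * κ) (sym (twoFresh≡0 joins))))) (m≤n+m _ _)
            where
            touched≡0 : ∀ s → s ≢ fresh → isFresh s ≡ 0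
            touched≡0 fresh ne = ⊥-elim (ne refl)
            touched≡0 hub _ = refl
            touched≡0 rim _ = refl
            touched≡0 leaf _ = refl
            touched≡0 twig _ = refl
            twoFresh≡0 : ∀ {p : Fin n × Fin n} → p ≡ (f′ , y) ⊎ p ≡ (y , f′) → isFresh (ρ (proj₁ p)) * isFresh (ρ (proj₂ p)) ≡ 0
            twoFresh≡0 (inj₁ refl) = trans (cong (isFresh (ρ f′) *_) (touched≡0 (ρ y) ρy)) (*-zeroʳ (isFresh (ρ f′)))
            twoFresh≡0 (inj₂ refl) = cong (_* isFresh (ρ f′)) (touched≡0 (ρ y) ρy)
          surcharge≤ : ∀ {k} → level (ρ y) ≤ 2 → surcharge ε q ≡ k → k ≤ ⟦ edgePriority ρ e ≤ᵇ 2 ⟧ * surcharge ε q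
          surcharge≤ l refl = ≤-reflexive (trans (sym (+-identityʳ _))
            (cong (_* surcharge ε q) (sym (Greedy.⟦≤ᵇ⟧-yes (edgePriority ρ) (≤-trans (≤-reflexive level≡) l)))))
          loss : level (ρ y) ≤ 2 → ε ≡ true → LosesAtMost f mk′ br′ u′ (price ρ r x c q ε e)
          loss l ε≡ = loses-certain {f} {mk′} {br′} {u′} {price ρ r x c q ε e} (≤-trans (surcharge≤ l (cong (λ ε → surcharge ε q) ε≡)) (m≤n+m _ (twoFresh ρ e * base r x (suc c) (q ∸ 4) + notTwoFresh ρ e * κ)))
          outer : child (ρ y) ≡ leaf → ρ y ≢ twig → LosesAtMost f mk′ br′ u′ (price ρ r x c q ε e)
          outer child≡ not-twig = loses-mono {f} {mk′} {br′} {u′} (≤-trans (≤-reflexive (+-identityʳ κ)) (≤-trans κ≤ (m≤m+n _ _)))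
            (early r f {mk′} {br′} {u′} {suc x} {c} {suc q} {false}
              (E′ not-twig (≤-trans (count₁ child≡) (none≤ twigs≤u τ≤))) (next-round {suc x} {c} refl) length≤)
          attach : ∀ s → ρ y ≡ s → LosesAtMost f mk′ br′ u′ (price ρ r x c q ε e)
          attach fresh y≡ = ⊥-elim (ρy y≡)
          attach hub y≡ = outer (cong child y≡) (λ t → distinct (trans (sym y≡) t))
            where
            distinct : hub ≢ twig
            distinct ()
          attach rim y≡ = outer (cong child y≡) (λ t → distinct (trans (sym y≡) t))
            where
            distinct : rim ≢ twig
            distinct ()
          attach leaf y≡ = hit ε refl
            where
            distinct : leaf ≢ twig
            distinct ()
            l : level (ρ y) ≤ 2
            l = ≤-reflexive (cong level y≡)
            hit : ∀ ε′ → ε ≡ ε′ → LosesAtMost f mk′ br′ u′ (price ρ r x c q ε e)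
            -- A second twig at this moment could leave `2 u` edges at twigs, more than the
            -- invariant `twigs` admits.
            hit true ε≡ = loss l ε≡
            hit false ε≡ = loses-mono {f} {mk′} {br′} {u′}
              (+-mono-≤ κ≤ (≤-trans (≤-reflexive (+-identityʳ (suc q * u))) (surcharge≤ l (cong (λ ε → surcharge ε q) ε≡))))
              (early r f {mk′} {br′} {u′} {suc x} {c} {suc q} {true}
                (E′ (λ t → distinct (trans (sym y≡) t)) twigs′) (next-round {suc x} {c} refl) length≤)
              where
              twigs′ : count≤ 1 (roles mk′) u′ ≤ 1 * u
              twigs′ = ≤-trans (count₁₂ 1) (≤-trans (∸-monoˡ-≤ b (+-monoˡ-≤ n (subst (λ ε → count≤ 1 ρ us ≤ ⟦ ε ⟧ * u) ε≡ twigs)))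
                (≤-reflexive (trans (cong (_∸ b) n≡) (trans (m+n∸m≡n b u) (sym (+-identityʳ u))))))
          attach twig y≡ = hit ε refl
            where
            hit : ∀ ε′ → ε ≡ ε′ → LosesAtMost f mk′ br′ u′ (price ρ r x c q ε e)
            hit true ε≡ = loss (≤-trans (≤-reflexive (cong level y≡)) (s≤s z≤n)) ε≡
            hit false ε≡ = absent 1 (subst (λ ε → count≤ 1 ρ us ≤ ⟦ ε ⟧ * u) ε≡ twigs) (≤-reflexive (trans level≡ (cong level y≡)))
        reply (none p) = absent 0 inner (≤-reflexive p)

  start : Early [] (allEdges n) 0 0 0 false
  start = record
    { position = record
      { available = λ _ → ≤-refl
      ; census = record
        { hubs = ∑-zero (allFin n)
        ; touched = ∑-zero (allFin n)
        ; freshes = trans (+-identityʳ _) (card-1 n)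
        }
      ; forest = record { parent = λ _ → nothing ; edges = λ () ; touched = λ () ; decreasing = λ () }
      }
    ; size = ≤-reflexive (trans (sym (allEdges-length n)) (cong (_+ n) (sym (+-identityʳ (2 * length (allEdges n))))))
    ; inner = ≤-reflexive (∑-zero (allEdges n))
    ; twigs = ≤-reflexive (∑-zero (allEdges n))
    ; queue = ≤-reflexive (∑-zero (allEdges n))
    ; backlog = inj₂ (∑-zero (allEdges n))
    }

  potential-start : potential T₁ 0 0 0 false ≤ 1 + T₁ + Z * (25 * T₁)
  potential-start = ≤-trans (≤-reflexive (+-identityʳ _)) (+-monoʳ-≤ (1 + T₁) (≤-trans (weigh≤ (0 <? x₀)) (≤-reflexive
    (cong (λ z → Z * (z * z + 25 * T₁)) (trans (cong (_∸ 0) (0∸n≡0 T₀)) refl)))))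
    where
    weigh≤ : ∀ d {k} → weigh {0} d k ≤ Z * k
    weigh≤ (yes _) = ≤-refl
    weigh≤ (no _) = z≤n

  wins : ∀ ε → 0ℚ ℚ.< ε → (1 + T₁ + Z * (25 * T₁)) * ↧ₙ ε ≤ suc D →
    ProbAtLeast (outcomes (breaker n)) BreakerWins (1ℚ ℚ.- ε)
  wins ε 0<ε h = winning-probability {length (allEdges n)} {[]} {[]} {allEdges n} {potential T₁ 0 0 0 false} ε 0<ε
    (≤-trans (*-monoˡ-≤ (↧ₙ ε) potential-start) h)
    (early T₁ (length (allEdges n)) {[]} {[]} start refl ≤-refl)

-- Choice of the parameters

module Scaled {n m : ℕ} (1000≤m : 1000 ≤ m) (n≥ : 1000 * m ≤ n) (n< : n < 1000 * m + 1000) where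
  open Scale 1000≤m
  open ≤-Reasoning

  u : ℕ
  u = n ∸ bias n

  100*bias≤ : bias n * 100 ≤ 99 * n
  100*bias≤ = m/n*n≤m (99 * n) 100

  99*n< : 99 * n < 100 + bias n * 100
  99*n< = begin-strict
    99 * n ≡⟨ m≡m%n+[m/n]*n (99 * n) 100 ⟩
    (99 * n) % 100 + bias n * 100 <⟨ +-monoˡ-< (bias n * 100) (m%n<n (99 * n) 100) ⟩
    100 + bias n * 100 ∎

  bias<n : bias n < n
  bias<n = *-cancelʳ-< 100 (bias n) n (≤-<-trans 100*bias≤ (subst (99 * n <_) (r n)
    (m<m+n (99 * n) (≤-trans 1≤m (≤-trans (m≤m+n m (999 * m)) n≥)))))
    where
    r : ∀ n → 99 * n + n ≡ n * 100
    r = solve-∀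

  n≡bias+u : n ≡ bias n + u
  n≡bias+u = sym (m+[n∸m]≡n (<⇒≤ bias<n))

  small : ∀ {a} → a ≤ 1000 → a ≤ m
  small h = ≤-trans h 1000≤m

  u≤ : u ≤ 10 * m + 10
  u≤ = ≤-pred (*-cancelʳ-< 100 u (suc (10 * m + 10)) (+-cancelˡ-< (bias n * 100 + 99 * n) _ _ (begin-strict
    bias n * 100 + 99 * n + u * 100 ≡⟨ r₁ (bias n) u (99 * n) ⟩
    (bias n + u) * 100 + 99 * n ≡⟨ cong (λ z → z * 100 + 99 * n) (sym n≡bias+u) ⟩
    n * 100 + 99 * n ≡⟨ r₂ n ⟩
    99 * n + n + 99 * n <⟨ +-monoˡ-< (99 * n) (+-mono-< 99*n< n<) ⟩
    100 + bias n * 100 + (1000 * m + 1000) + 99 * n ≡⟨ r₃ (bias n * 100) (99 * n) m ⟩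
    bias n * 100 + 99 * n + suc (10 * m + 10) * 100 ∎)))
    where
    r₁ : ∀ b u z → b * 100 + z + u * 100 ≡ (b + u) * 100 + z
    r₁ = solve-∀
    r₂ : ∀ n → n * 100 + 99 * n ≡ 99 * n + n + 99 * n
    r₂ = solve-∀
    r₃ : ∀ b z m → 100 + b + (1000 * m + 1000) + z ≡ b + z + suc (10 * m + 10) * 100
    r₃ = solve-∀

  u≤12m : u ≤ 12 * m
  u≤12m = ≤-trans u≤ (≤-trans (+-monoʳ-≤ (10 * m) (small (≤ᵇ⇒≤ 10 1000 _))) (gap m (r m)))
    where
    r : ∀ m → 12 * m ≡ 10 * m + m + m
    r = solve-∀

  room : ∀ {x c} → x + c ≤ 180 * m → x + 2 * c + suc (x + 2 * c) + 4 * u ≤ bias n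
  room {x} {c} t≤ = +-cancelʳ-≤ u _ _ (begin
    x + 2 * c + suc (x + 2 * c) + 4 * u + u ≤⟨ gap (2 * x) (r₁ x c u) ⟩
    4 * (x + c) + 1 + 5 * u ≤⟨ +-mono-≤ (+-monoˡ-≤ 1 (*-monoʳ-≤ 4 t≤)) (*-monoʳ-≤ 5 u≤) ⟩
    4 * (180 * m) + 1 + 5 * (10 * m + 10) ≡⟨ r₂ m ⟩
    770 * m + 51 ≤⟨ +-monoʳ-≤ (770 * m) (small (≤ᵇ⇒≤ 51 1000 _)) ⟩
    770 * m + m ≤⟨ gap (229 * m) (r₃ m) ⟩
    1000 * m ≤⟨ n≥ ⟩
    n ≡⟨ n≡bias+u ⟩
    bias n + u ∎)
    where
    r₁ : ∀ x c u → 4 * (x + c) + 1 + 5 * u ≡ x + 2 * c + suc (x + 2 * c) + 4 * u + u + 2 * x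
    r₁ = solve-∀
    r₂ : ∀ m → 4 * (180 * m) + 1 + 5 * (10 * m + 10) ≡ 770 * m + 51
    r₂ = solve-∀
    r₃ : ∀ m → 1000 * m ≡ 770 * m + m + 229 * m
    r₃ = solve-∀

  n≤1001m : n ≤ 1001 * m
  n≤1001m = ≤-trans (<⇒≤ n<) (≤-trans (+-monoʳ-≤ (1000 * m) 1000≤m) (≤-reflexive (r m)))
    where
    r : ∀ m → 1000 * m + m ≡ 1001 * m
    r = solve-∀

  parameters : Parameters n (288000 * (m * m)) 4500 (100 * m) (180 * m) (12 * m) u
  parameters = record
    { n≡ = n≡bias+u
    ; bias< = bias<n
    ; room = λ {x} {c} → room {x} {c}
    ; u≤x₀ = u≤12m
    ; cleared = λ {M} {x} {c} → backlog-cleared {u} {M} {x} {c} {m} u≤ (small′ 1000≤m)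
    ; fatal = λ {x} → shortfall-fatal {x}
    ; denominator = λ {L} {t} t≤ → denominator≤ {n} {L} {t} n≥ t≤
    ; unit² = λ {L} {t} t≤ len → unit²≤ {n} {L} {t} n≥ t≤ len {u} u≤
    ; rare = λ {L} {F} {O} {M} {x} {c} {φ} t≤ → one-fresh-rare {n} {L} {F} {O} {M} {u} {x} {c} {φ} n≥ t≤ u≤
    ; frequent = λ {L} {F} {O} {x} {c} {φ} t≥ t≤ x< → one-fresh-frequent {n} {L} {F} {O} {x} {c} {φ} n≥ n≤1001m t≥ t≤ (<⇒≤ x<)
    }
    where
    small′ : 1000 ≤ m → 100 ≤ m
    small′ = ≤-trans (≤ᵇ⇒≤ 100 1000 _)

  -- 71 is the least integer whose product with 288000 reaches 20250181 = 1 + 180 + 4500 * 25 * 180.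
  initial≤ : ∀ d → 71 * d ≤ m → (1 + 180 * m + 4500 * (25 * (180 * m))) * d ≤ suc (288000 * (m * m))
  initial≤ d h = ≤-trans (linear 180 4500 25 d) (≤-trans (*-monoˡ-≤ (m * d) (≤ᵇ⇒≤ 20250181 20448000 _))
    (≤-trans (quadratic 288000 71 h) (n≤1+n _)))
    where
    linear : ∀ a b c d → (1 + a * m + b * (c * (a * m))) * d ≤ (1 + a + b * (c * a)) * (m * d)
    linear a b c d = ≤-trans (*-monoˡ-≤ d (+-monoˡ-≤ (b * (c * (a * m))) (+-monoˡ-≤ (a * m) 1≤m)))
      (≤-reflexive (r a b c m d))
      where
      r : ∀ a b c m d → (m + a * m + b * (c * (a * m))) * d ≡ (1 + a + b * (c * a)) * (m * d)
      r = solve-∀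
    quadratic : ∀ a b → b * d ≤ m → a * b * (m * d) ≤ a * (m * m)
    quadratic a b h = ≤-trans (≤-reflexive (r a b m d)) (*-monoʳ-≤ a (*-monoʳ-≤ m h))
      where
      r : ∀ a b m d → a * b * (m * d) ≡ a * (m * (b * d))
      r = solve-∀

theorem2 : Σ ((n : ℕ) → BreakerStrategy n) λ strat →
    ((n : ℕ) → Legal (bias n) (strat n))
    × ((ε : ℚ) → 0ℚ ℚ.< ε → ∃ λ N → (n : ℕ) → n ≥ N →
    ProbAtLeast (outcomes (strat n)) BreakerWins (1ℚ ℚ.- ε))
theorem2 = breaker
  , (λ n mk br u → Greedy.greedy-count (edgePriority (roles mk)) (bias n) u)
  , λ ε 0<ε → (1000 + 71 * ↧ₙ ε) * 1000 , λ n n≥N →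
      let m = n / 1000
          m≥ : 1000 + 71 * ↧ₙ ε ≤ m
          m≥ = ≤-trans (≤-reflexive (sym (m*n/n≡m (1000 + 71 * ↧ₙ ε) 1000))) (/-monoˡ-≤ 1000 n≥N)
          1000m≤ : 1000 * m ≤ n
          1000m≤ = ≤-trans (≤-reflexive (*-comm 1000 m)) (m/n*n≤m n 1000)
          n< : n < 1000 * m + 1000
          n< = subst₂ _<_ (sym (m≡m%n+[m/n]*n n 1000)) (trans (+-comm 1000 (m * 1000)) (cong (_+ 1000) (*-comm m 1000)))
                 (+-monoˡ-< (m * 1000) (m%n<n n 1000))
          1000≤m = ≤-trans (m≤m+n 1000 (71 * ↧ₙ ε)) m≥
          open Scaled {n} {m} 1000≤m 1000m≤ n<
      in Phase.wins parameters ε 0<ε (initial≤ (↧ₙ ε) (≤-trans (m≤n+m (71 * ↧ₙ ε) 1000) m≥))
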